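{- Let $\mathbb{K}$ be a computable field and $\mathcal{A}$ an $\omega$-well structured, well ordered and computable domain of variables. Then the problem Ideal-memb in $\mathbb{K}[\mathcal{A}]$ is decidable: given a polynomial $f\in\mathbb{K}[\mathcal{A}]$ and a finite set $\mathcal{B}\subseteq\mathbb{K}[\mathcal{A}]$, one can decide whether $f$ belongs to the equivariant ideal generated by $\mathcal{B}$.
   Context: A domain of variables $\mathcal{A}=(A,r_1,\dots,r_n)$ is a countable relational structure (equality always definable; definable = Boolean combination of the $r_i$). It is well ordered if some well order on $A$ is definable. Embeddings are maps $A\to A$ preserving and reflecting all relations; $\mathrm{Emb}(\mathcal{A})$ denotes them. $\omega$-well structured: the quasi order on labellings $\ell:B\to\mathbb{N}$ of finite $B\subseteq A$, given by $\ell\rightsquigarrow\ell'$ (with $\ell':B'\to\mathbb{N}$) iff some embedding $\iota$ satisfies $\iota(B)\subseteq B'$ and $\ell(b)\le\ell'(\iota(b))$ for $b\in B$, is a well quasi order. For finite $B\subseteq A$ let $\mathrm{Emb}_B=\{\iota|_B:\iota\in\mathrm{Emb}(\mathcal{A})\}$. $\mathcal{A}$ is computable if elements of $A$ are finitely represented and: (C1) given finite $B\subseteq A$ and $\pi:B\to A$ one can decide whether $\pi\in\mathrm{Emb}_B$; (C2) given finite $B,B'\subseteq A$ one can compute a finite $F\subseteq\mathrm{Emb}_B\times\mathrm{Emb}_{B'}$ such that every pair in $\mathrm{Emb}_B\times\mathrm{Emb}_{B'}$ equals $(\kappa\circ\pi,\kappa\circ\pi')$ for some $\kappa\in\mathrm{Emb}(\mathcal{A})$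 and $(\pi,\pi')\in F$. A computable field has finitely represented elements with computable field operations. $\mathbb{K}[\mathcal{A}]$ is the polynomial ring over $\mathbb{K}$ with variables the elements of $A$; embeddings act by renaming variables. The equivariant ideal generated by $\mathcal{B}$ is the set of all $\sum_i h_i\cdot\iota_i(g_i)$ with $g_i\in\mathcal{B}$, $h_i\in\mathbb{K}[\mathcal{A}]$, $\iota_i\in\mathrm{Emb}(\mathcal{A})$. -}

module Defs where

open import Level using (Level; _⊔_; suc)
open import Data.Nat as ℕ using (ℕ; _<_; _≤_)
import Data.Nat.Properties as ℕP
open import Data.Fin using (Fin)
import Data.Fin as Fin
open import Data.Bool using (Bool; true; false; if_then_else_; _∧_)
open import Data.List using (List; []; _∷_; _++_; map; foldr; concatMap)
open import Data.List.Membership.Propositional using (_∈_)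
open import Data.Vec using (Vec)
import Data.Vec as Vec
open import Data.Product using (Σ; ∃; _×_; _,_; proj₁; proj₂)
open import Data.Sum using (_⊎_)
open import Data.Empty using (⊥)
open import Relation.Nullary using (¬_; Dec; does)
open import Relation.Binary.PropositionalEquality using (_≡_; _≢_)
open import Relation.Binary.Definitions using (Transitive; DecidableEquality)
open import Induction.WellFounded using (WellFounded)
open import Algebra.Bundles using (CommutativeRing)
open import Function using (Injective)

-- A field: a commutative ring (with setoid equality ≈) with 1 ≉ 0 in which
-- every nonzero element has a multiplicative inverse.
-- Computable: elements are Agda data, operations are Agda functions, and
-- equality of field elements is decidable.
record ComputableField (c ℓ : Level) : Set (Level.suc (c ⊔ ℓ)) where
  field
    cring   : CommutativeRing c ℓ
  open CommutativeRing cring public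
  field
    1≉0     : ¬ (1# ≈ 0#)
    inverse : ∀ x → ¬ (x ≈ 0#) → Σ Carrier λ y → (x * y) ≈ 1#
    _≟_     : ∀ x y → Dec (x ≈ y)

record Domain : Set₁ where
  field
    A      : Set
    -- countable / finitely represented: an injective coding into ℕ
    code   : A → ℕ
    code-injective : Injective _≡_ _≡_ code
    n      : ℕ
    arity  : Fin n → ℕ
    rel    : (i : Fin n) → Vec A (arity i) → Set

  _≟A_ : DecidableEquality A
  x ≟A y with code x ℕP.≟ code y
  ... | Relation.Nullary.yes p = Relation.Nullary.yes (code-injective p)
  ... | Relation.Nullary.no ¬p = Relation.Nullary.no λ { Relation.Binary.PropositionalEquality.refl → ¬p Relation.Binary.PropositionalEquality.refl }

  -- Embeddings: maps A → A preserving and reflecting all relations and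
  -- equality (equality is always definable, hence injectivity).
  IsEmb : (A → A) → Set
  IsEmb ι = Injective _≡_ _≡_ ι
          × (∀ (i : Fin n) (xs : Vec A (arity i)) →
               (rel i xs → rel i (Vec.map ι xs)) × (rel i (Vec.map ι xs) → rel i xs))

  data Formula (k : ℕ) : Set where
    atom : (i : Fin n) → Vec (Fin k) (arity i) → Formula k
    eq   : Fin k → Fin k → Formula k
    neg  : Formula k → Formula k
    and  : Formula k → Formula k → Formula k

  ⟦_⟧ : ∀ {k} → Formula k → (Fin k → A) → Set
  ⟦ atom i vs ⟧ ρ = rel i (Vec.map ρ vs)
  ⟦ eq x y    ⟧ ρ = ρ x ≡ ρ y
  ⟦ neg φ     ⟧ ρ = ¬ ⟦ φ ⟧ ρ
  ⟦ and φ ψ   ⟧ ρ = ⟦ φ ⟧ ρ × ⟦ ψ ⟧ ρ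

  defRel : Formula 2 → A → A → Set
  defRel φ x y = ⟦ φ ⟧ (λ { Fin.zero → x ; (Fin.suc Fin.zero) → y })

  -- Emb_B membership: π : B → A (represented by A → A, only values on B
  -- matter) is the restriction of some embedding to B.
  InEmb : List A → (A → A) → Set
  InEmb B π = Σ (A → A) λ ι → IsEmb ι × (∀ {b} → b ∈ B → ι b ≡ π b)

  -- Labellings ℓ : B → ℕ of finite B ⊆ A (B a list, ℓ only matters on B)
  record Labelling : Set where
    constructor lab
    field
      dom   : List A
      label : A → ℕ
  open Labelling public

  _⇝_ : Labelling → Labelling → Set
  ℓ ⇝ ℓ' = Σ (A → A) λ ι → IsEmb ι ×
             (∀ {b} → b ∈ dom ℓ → (ι b ∈ dom ℓ') × (label ℓ b ≤ label ℓ' (ι b)))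


IsWellOrder : {X : Set} → (X → X → Set) → Set
IsWellOrder {X} R = (∀ x → ¬ R x x) × Transitive R
                  × (∀ x y → x ≢ y → R x y ⊎ R y x) × WellFounded R

WellOrdered : Domain → Set
WellOrdered D = Σ (Formula 2) λ φ → IsWellOrder (defRel φ)
  where open Domain D

OmegaWellStructured : Domain → Set
OmegaWellStructured D = (s : ℕ → Labelling) → Σ ℕ λ i → Σ ℕ λ j → i < j × (s i ⇝ s j)
  where open Domain D

-- Computable domain: (C1) and (C2).  (Finite representation of elements is
-- part of Domain: the injective coding into ℕ.)
record Computable (D : Domain) : Set₁ where
  open Domain D
  field
    C1 : (B : List A) (π : A → A) → Dec (InEmb B π)
    C2 : (B B' : List A) →
         Σ (List ((A → A) × (A → A))) λ F →
           (∀ {p} → p ∈ F → InEmb B (proj₁ p) × InEmb B' (proj₂ p))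
         × (∀ ι ι' → IsEmb ι → IsEmb ι' →
              Σ (A → A) λ κ → IsEmb κ × Σ ((A → A) × (A → A)) λ p → p ∈ F
                × (∀ {b} → b ∈ B → ι b ≡ κ (proj₁ p b))
                × (∀ {b} → b ∈ B' → ι' b ≡ κ (proj₂ p b)))

module Poly {c ℓ : Level} (K : ComputableField c ℓ) (D : Domain) where
  open ComputableField K
  open Domain D

  -- monomials: finite multisets of variables, as lists
  Monomial : Set
  Monomial = List A

  count : A → Monomial → ℕ
  count a = foldr (λ x k → if does (a ≟A x) then ℕ.suc k else k) 0

  sameMon : Monomial → Monomial → Bool
  sameMon m m' = foldr (λ a b → does (count a m ℕP.≟ count a m') ∧ b) true (m ++ m')

  -- polynomials: formal finite sums of terms c·m
  Pol : Set c
  Pol = List (Carrier × Monomial)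

  coeff : Pol → Monomial → Carrier
  coeff p m = foldr (λ t acc → if sameMon m (proj₂ t) then proj₁ t + acc else acc) 0# p

  _≃_ : Pol → Pol → Set ℓ
  p ≃ q = ∀ m → coeff p m ≈ coeff q m

  0P : Pol
  0P = []

  _+P_ : Pol → Pol → Pol
  _+P_ = _++_

  _*P_ : Pol → Pol → Pol
  p *P q = concatMap (λ t → map (λ u → (proj₁ t * proj₁ u , proj₂ t ++ proj₂ u)) q) p

  rename : (A → A) → Pol → Pol
  rename ι = map (λ t → (proj₁ t , map ι (proj₂ t)))

  record Summand (𝓑 : List Pol) : Set (c ⊔ Level.zero) where
    field
      h   : Pol
      ι   : A → A
      ι-emb : IsEmb ι
      g   : Pol
      g∈𝓑 : g ∈ 𝓑

  evalSum : {𝓑 : List Pol} → List (Summand 𝓑) → Pol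
  evalSum = foldr (λ s acc → (Summand.h s *P rename (Summand.ι s) (Summand.g s)) +P acc) 0P

  InEqIdeal : Pol → List Pol → Set (c ⊔ ℓ)
  InEqIdeal f 𝓑 = Σ (List (Summand 𝓑)) λ ss → f ≃ evalSum ss

{-# OPTIONS --safe #-}
module Submission where

-- Embeddings are monotone for the definable well order, so they preserve the lexicographic order
-- on monomials that compares exponents of the largest variable first; this order is well founded.
-- Buchberger's algorithm therefore works up to embeddings: division by renamed basis elements
-- terminates and is effective by (C1), and by (C2) the overlaps of two renamed basis elements are,
-- up to a common embedding and a monomial factor, finitely many.  The leading monomial of a nonzero
-- remainder is divisible by no renaming of an earlier leading monomial, hence the well quasi order
-- exhibits a stage at which all S-polynomials reduce to zero.  At that stage f lies in the ideal
-- iff its remainder vanishes.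

open import Defs
open import Level using (Level; _⊔_)
open import Data.Bool using (true; false; if_then_else_; _∧_)
open import Data.Empty using (⊥-elim)
open import Data.Fin using (Fin; zero; suc)
open import Data.List using (List; []; _∷_; _++_; map; foldr; concat; filter)
open import Data.List.Membership.Propositional using (_∈_; _∉_; find; lose)
open import Data.List.Membership.Propositional.Properties
  using (∈-++⁺ˡ; ∈-++⁺ʳ; ∈-map⁺; ∈-map⁻; ∈-filter⁻; ∈-concat⁺′)
import Data.List.Membership.DecPropositional as DecMembership
open import Data.List.Properties using (map-id; map-++; ++-assoc; ++-identityʳ; map-∘)
open import Data.List.Relation.Unary.All as All using (All; []; _∷_)
import Data.List.Relation.Unary.All.Properties as AllP
open import Data.List.Relation.Unary.Any using (Any; here; there; any?)
open import Data.Nat as ℕ using (ℕ; _∸_; z≤n; s≤s)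
import Data.Nat.Properties as ℕP
open import Data.Product using (Σ; _×_; _,_; proj₁; proj₂)
open import Data.Sum using (_⊎_; inj₁; inj₂; [_,_]′)
open import Data.Unit using (⊤; tt)
open import Data.Vec using (Vec)
import Data.Vec as Vec
import Data.Vec.Properties as VecP
open import Function using (_∘_; id; Injective)
open import Induction.WellFounded using (Acc; acc; WellFounded)
open import Relation.Binary.Definitions using (Transitive; Decidable; DecidableEquality; tri<; tri≈; tri>)
open import Relation.Binary.PropositionalEquality as ≡ using (_≡_; _≢_; refl)
open import Relation.Nullary using (¬_; Dec; yes; no; does)
open import Relation.Nullary.Decidable using (map′; ¬?; decidable-stable; _×-dec_; dec-true; dec-false)

-- Comparing the largest variable first is forced. With the smallest variable first, x0 > x1 > x2 >
-- ... would descend forever as soon as the variables contain a copy of the natural numbers. The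
-- obstacle to the usual criterion is that embeddings produce infinitely many overlaps, even of an
-- element with itself. The criterion is therefore stated for all overlaps, and the finite check is
-- transferred to them. What makes the transfer work is that bounds are imposed on the leading
-- monomial of each summand of a representation, not on the sum: renaming by an embedding and
-- multiplication by a monomial are strictly monotone, so a representation below an overlap is
-- carried to a representation below its image. The completion is not a recursion that has to
-- terminate. It is an infinite sequence of bases, and the well quasi order, being constructive
-- data, returns the two stages to inspect.

module Embeddings (D : Domain) where
  open Domain D

  -- Both directions are proved at once because negation exchanges them. The second valuation is
  -- given only up to pointwise equality, which avoids function extensionality.
  formula-emb : ∀ {ι} → IsEmb ι → ∀ {k} (φ : Formula k) {ρ ρ' : Fin k → A} → (∀ i → ι (ρ i) ≡ ρ' i) →
                (⟦ φ ⟧ ρ → ⟦ φ ⟧ ρ') × (⟦ φ ⟧ ρ' → ⟦ φ ⟧ ρ)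
  formula-emb {ι} e (atom i vs) {ρ} {ρ'} h =
      (λ r → ≡.subst (rel i) eqn (proj₁ (proj₂ e i _) r))
    , (λ r → proj₂ (proj₂ e i _) (≡.subst (rel i) (≡.sym eqn) r))
    where
    eqn : Vec.map ι (Vec.map ρ vs) ≡ Vec.map ρ' vs
    eqn = ≡.trans (≡.sym (VecP.map-∘ ι ρ vs)) (VecP.map-cong h vs)
  formula-emb {ι} e (eq x y) h =
      (λ r → ≡.trans (≡.sym (h x)) (≡.trans (≡.cong ι r) (h y)))
    , (λ r → proj₁ e (≡.trans (h x) (≡.trans r (≡.sym (h y)))))
  formula-emb e (neg φ) h =
    let (f , g) = formula-emb e φ h in (λ r s → r (g s)) , (λ r s → r (f s))
  formula-emb e (and φ ψ) h =
    let (f , g) = formula-emb e φ h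
        (f' , g') = formula-emb e ψ h
    in (λ { (r , s) → f r , f' s }) , (λ { (r , s) → g r , g' s })

  defRel-emb : ∀ {ι} → IsEmb ι → (φ : Formula 2) → ∀ {x y} →
               (defRel φ x y → defRel φ (ι x) (ι y)) × (defRel φ (ι x) (ι y) → defRel φ x y)
  defRel-emb e φ = formula-emb e φ λ { zero → refl ; (suc zero) → refl }

  id-emb : IsEmb id
  id-emb = id , λ i xs → ≡.subst (rel i) (≡.sym (VecP.map-id xs)) , ≡.subst (rel i) (VecP.map-id xs)

  ∘-emb : ∀ {κ ι} → IsEmb κ → IsEmb ι → IsEmb (κ ∘ ι)
  ∘-emb {κ} {ι} (κ-inj , κ-rel) (ι-inj , ι-rel) =
      ι-inj ∘ κ-inj
    , λ i xs → let eqn = VecP.map-∘ κ ι xs in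
        (λ r → ≡.subst (rel i) (≡.sym eqn) (proj₁ (κ-rel i _) (proj₁ (ι-rel i xs) r)))
      , (λ r → proj₂ (ι-rel i xs) (proj₂ (κ-rel i _) (≡.subst (rel i) eqn r)))

-- Finite searches: maximal elements and exhaustive checks.

module _ {X : Set} {_<_ : X → X → Set} (irrefl : ∀ x → ¬ (x < x)) (trans : Transitive _<_)
         (_<?_ : Decidable _<_) {P : X → Set} (P? : ∀ x → Dec (P x)) where

  maximal : (xs : List X) →
            (∀ {x} → x ∈ xs → ¬ P x) ⊎ Σ X λ x → P x × (∀ {y} → y ∈ xs → P y → ¬ (x < y))
  maximal [] = inj₁ λ ()
  maximal (x ∷ xs) with P? x | maximal xs
  ... | no ¬px | inj₁ h = inj₁ λ { (here refl) → ¬px ; (there i) → h i }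
  ... | no ¬px | inj₂ (a , pa , h) =
    inj₂ (a , pa , λ { (here refl) py → ⊥-elim (¬px py) ; (there i) → h i })
  ... | yes px | inj₁ h =
    inj₂ (x , px , λ { (here refl) _ → irrefl x ; (there i) py → ⊥-elim (h i py) })
  ... | yes px | inj₂ (a , pa , h) with a <? x
  ... | yes a<x = inj₂ (x , px , λ { (here refl) _ → irrefl x ; (there i) py x<y → h i py (trans a<x x<y) })
  ... | no a≮x  = inj₂ (a , pa , λ { (here refl) _ → a≮x ; (there i) → h i })

search : ∀ {x y z} {X : Set x} {Q : X → Set y} {R : Set z} (xs : List X) →
         (∀ {x} → x ∈ xs → Q x ⊎ R) → (∀ {x} → x ∈ xs → Q x) ⊎ R
search [] h = inj₁ λ ()
search (x ∷ xs) h with h (here refl) | search xs (h ∘ there)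
... | inj₂ r | _ = inj₂ r
... | inj₁ _ | inj₂ r = inj₂ r
... | inj₁ q | inj₁ qs = inj₁ λ { (here refl) → q ; (there x∈) → qs x∈ }

-- Monomials as multisets: divisibility, quotients, least common multiples.

module Monomials {A : Set} (_≟A_ : DecidableEquality A) where
  open DecMembership _≟A_ using (_∈?_)

  Monomial : Set
  Monomial = List A

  count : A → Monomial → ℕ
  count a = foldr (λ x k → if does (a ≟A x) then ℕ.suc k else k) 0

  infix 4 _≈ₘ_ _⊑_
  record _≈ₘ_ (m m' : Monomial) : Set where
    constructor mk≈
    field count-≈ : ∀ a → count a m ≡ count a m'
  open _≈ₘ_ public

  record _⊑_ (m m' : Monomial) : Set where
    constructor mk⊑
    field count-⊑ : ∀ a → count a m ℕ.≤ count a m'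
  open _⊑_ public

  ≈ₘ-refl : ∀ {m} → m ≈ₘ m
  ≈ₘ-refl = mk≈ λ _ → refl

  ≈ₘ-reflexive : ∀ {m m'} → m ≡ m' → m ≈ₘ m'
  ≈ₘ-reflexive refl = ≈ₘ-refl

  ≈ₘ-sym : ∀ {m m'} → m ≈ₘ m' → m' ≈ₘ m
  ≈ₘ-sym e = mk≈ λ a → ≡.sym (count-≈ e a)

  ≈ₘ-trans : ∀ {m m' m''} → m ≈ₘ m' → m' ≈ₘ m'' → m ≈ₘ m''
  ≈ₘ-trans e e' = mk≈ λ a → ≡.trans (count-≈ e a) (count-≈ e' a)

  ≈ₘ⇒⊑ : ∀ {m m'} → m ≈ₘ m' → m ⊑ m'
  ≈ₘ⇒⊑ e = mk⊑ λ a → ℕP.≤-reflexive (count-≈ e a)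

  ⊑-trans : ∀ {m m' m''} → m ⊑ m' → m' ⊑ m'' → m ⊑ m''
  ⊑-trans e e' = mk⊑ λ a → ℕP.≤-trans (count-⊑ e a) (count-⊑ e' a)

  ⊑-antisym : ∀ {m m'} → m ⊑ m' → m' ⊑ m → m ≈ₘ m'
  ⊑-antisym e e' = mk≈ λ a → ℕP.≤-antisym (count-⊑ e a) (count-⊑ e' a)

  count-≡ : ∀ a m → count a (a ∷ m) ≡ ℕ.suc (count a m)
  count-≡ a m rewrite dec-true (a ≟A a) refl = refl

  count-≢ : ∀ {a x} m → a ≢ x → count a (x ∷ m) ≡ count a m
  count-≢ {a} {x} m a≢x rewrite dec-false (a ≟A x) a≢x = refl

  count-++ : ∀ a m m' → count a (m ++ m') ≡ count a m ℕ.+ count a m'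
  count-++ a [] m' = refl
  count-++ a (x ∷ m) m' with does (a ≟A x)
  ... | true  = ≡.cong ℕ.suc (count-++ a m m')
  ... | false = count-++ a m m'

  ∉⇒count≡0 : ∀ {a} m → a ∉ m → count a m ≡ 0
  ∉⇒count≡0 [] a∉ = refl
  ∉⇒count≡0 (x ∷ m) a∉ = ≡.trans (count-≢ m (a∉ ∘ here)) (∉⇒count≡0 m (a∉ ∘ there))

  count<⇒∈ : ∀ {a k} m → k ℕ.< count a m → a ∈ m
  count<⇒∈ {a} m k< with a ∈? m
  ... | yes a∈ = a∈
  ... | no a∉ = ⊥-elim (ℕP.n≮0 (≡.subst (_ ℕ.<_) (∉⇒count≡0 m a∉) k<))

  ∈⇒0<count : ∀ {a} m → a ∈ m → 0 ℕ.< count a m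
  ∈⇒0<count {a} (x ∷ m) a∈ with a ≟A x
  ... | yes _ = s≤s z≤n
  ∈⇒0<count (x ∷ m) (here refl) | no a≢x = ⊥-elim (a≢x refl)
  ∈⇒0<count (x ∷ m) (there a∈) | no a≢x = ∈⇒0<count m a∈

  count-map : ∀ {ι} → Injective _≡_ _≡_ ι → ∀ a m → count (ι a) (map ι m) ≡ count a m
  count-map inj a [] = refl
  count-map {ι} inj a (x ∷ m) with a ≟A x
  ... | yes refl = ≡.trans (count-≡ (ι a) (map ι m)) (≡.cong ℕ.suc (count-map inj a m))
  ... | no a≢x = ≡.trans (count-≢ (map ι m) (a≢x ∘ inj)) (count-map inj a m)

  ++-cong-≈ₘ : ∀ {m m' k k'} → m ≈ₘ m' → k ≈ₘ k' → m ++ k ≈ₘ m' ++ k'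
  ++-cong-≈ₘ {m} {m'} {k} {k'} e e' = mk≈ λ a →
    ≡.trans (count-++ a m k)
      (≡.trans (≡.cong₂ ℕ._+_ (count-≈ e a) (count-≈ e' a)) (≡.sym (count-++ a m' k')))

  ++-cancelʳ-≈ₘ : ∀ {m m'} k → m ++ k ≈ₘ m' ++ k → m ≈ₘ m'
  ++-cancelʳ-≈ₘ {m} {m'} k e = mk≈ λ a → ℕP.+-cancelʳ-≡ (count a k) (count a m) (count a m')
    (≡.trans (≡.sym (count-++ a m k)) (≡.trans (count-≈ e a) (count-++ a m' k)))

  ⊑-on-map : ∀ {ι} → Injective _≡_ _≡_ ι → ∀ m {k} →
             (∀ {a} → a ∈ m → count a m ℕ.≤ count (ι a) k) → map ι m ⊑ k
  ⊑-on-map {ι} inj m {k} h = mk⊑ bound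
    where
    bound : ∀ b → count b (map ι m) ℕ.≤ count b k
    bound b with b ∈? map ι m
    ... | no b∉ = ≡.subst (ℕ._≤ _) (≡.sym (∉⇒count≡0 (map ι m) b∉)) z≤n
    ... | yes b∈ with ∈-map⁻ ι b∈
    ... | a , a∈ , refl = ≡.subst (ℕ._≤ _) (≡.sym (count-map inj a m)) (h a∈)

  map-⊑ : ∀ {ι} → Injective _≡_ _≡_ ι → ∀ {m m'} → m ⊑ m' → map ι m ⊑ map ι m'
  map-⊑ inj {m} {m'} e =
    ⊑-on-map inj m λ {a} _ → ≡.subst (count a m ℕ.≤_) (≡.sym (count-map inj a m')) (count-⊑ e a)

  map-≈ₘ : ∀ {ι} → Injective _≡_ _≡_ ι → ∀ {m m'} → m ≈ₘ m' → map ι m ≈ₘ map ι m'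
  map-≈ₘ inj e = ⊑-antisym (map-⊑ inj (≈ₘ⇒⊑ e)) (map-⊑ inj (≈ₘ⇒⊑ (≈ₘ-sym e)))

  infixl 6 _∖_
  -- Truncated subtraction of exponents. The last occurrences are the ones removed: an `x` stays
  -- when the list behind it already holds as many copies of `x` as `k` does.
  _∖_ : Monomial → Monomial → Monomial
  [] ∖ k = []
  (x ∷ m) ∖ k = if does (count x k ℕ.≤? count x m) then x ∷ (m ∖ k) else m ∖ k

  ∖-keep : ∀ {x m k} → count x k ℕ.≤ count x m → (x ∷ m) ∖ k ≡ x ∷ (m ∖ k)
  ∖-keep {x} {m} {k} p rewrite dec-true (count x k ℕ.≤? count x m) p = refl

  ∖-drop : ∀ {x m k} → ¬ (count x k ℕ.≤ count x m) → (x ∷ m) ∖ k ≡ m ∖ k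
  ∖-drop {x} {m} {k} ¬p rewrite dec-false (count x k ℕ.≤? count x m) ¬p = refl

  count-∖ : ∀ a m k → count a (m ∖ k) ≡ count a m ∸ count a k
  count-∖ a [] k = ≡.sym (ℕP.0∸n≡0 (count a k))
  count-∖ a (x ∷ m) k = by-cases (a ≟A x) (count x k ℕ.≤? count x m)
    where
    open ≡.≡-Reasoning
    by-cases : Dec (a ≡ x) → Dec (count x k ℕ.≤ count x m) →
               count a ((x ∷ m) ∖ k) ≡ count a (x ∷ m) ∸ count a k
    by-cases (yes refl) (yes p) = begin
      count a ((a ∷ m) ∖ k)              ≡⟨ ≡.cong (count a) (∖-keep {m = m} {k} p) ⟩
      count a (a ∷ (m ∖ k))              ≡⟨ count-≡ a (m ∖ k) ⟩
      ℕ.suc (count a (m ∖ k))            ≡⟨ ≡.cong ℕ.suc (count-∖ a m k) ⟩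
      ℕ.suc (count a m ∸ count a k)      ≡⟨ ℕP.+-∸-assoc 1 p ⟨
      ℕ.suc (count a m) ∸ count a k      ≡⟨ ≡.cong (_∸ count a k) (count-≡ a m) ⟨
      count a (a ∷ m) ∸ count a k        ∎
    by-cases (yes refl) (no ¬p) = begin
      count a ((a ∷ m) ∖ k)              ≡⟨ ≡.cong (count a) (∖-drop {m = m} {k} ¬p) ⟩
      count a (m ∖ k)                    ≡⟨ count-∖ a m k ⟩
      count a m ∸ count a k              ≡⟨ ℕP.m≤n⇒m∸n≡0 (ℕP.<⇒≤ (ℕP.≰⇒> ¬p)) ⟩
      0                                  ≡⟨ ℕP.m≤n⇒m∸n≡0 (ℕP.≰⇒> ¬p) ⟨
      ℕ.suc (count a m) ∸ count a k      ≡⟨ ≡.cong (_∸ count a k) (count-≡ a m) ⟨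
      count a (a ∷ m) ∸ count a k        ∎
    by-cases (no a≢x) (yes p) = begin
      count a ((x ∷ m) ∖ k)              ≡⟨ ≡.cong (count a) (∖-keep {m = m} {k} p) ⟩
      count a (x ∷ (m ∖ k))              ≡⟨ count-≢ (m ∖ k) a≢x ⟩
      count a (m ∖ k)                    ≡⟨ count-∖ a m k ⟩
      count a m ∸ count a k              ≡⟨ ≡.cong (_∸ count a k) (count-≢ m a≢x) ⟨
      count a (x ∷ m) ∸ count a k        ∎
    by-cases (no a≢x) (no ¬p) = begin
      count a ((x ∷ m) ∖ k)              ≡⟨ ≡.cong (count a) (∖-drop {m = m} {k} ¬p) ⟩
      count a (m ∖ k)                    ≡⟨ count-∖ a m k ⟩
      count a m ∸ count a k              ≡⟨ ≡.cong (_∸ count a k) (count-≢ m a≢x) ⟨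
      count a (x ∷ m) ∸ count a k        ∎

  ∖-++ : ∀ {m k} → k ⊑ m → (m ∖ k) ++ k ≈ₘ m
  ∖-++ {m} {k} k⊑m = mk≈ λ a →
    ≡.trans (count-++ a (m ∖ k) k)
      (≡.trans (≡.cong (ℕ._+ count a k) (count-∖ a m k)) (ℕP.m∸n+n≡m (count-⊑ k⊑m a)))

  -- The exponentwise maximum, since subtracting with truncation and adding back yields the larger
  -- of two numbers.
  lcm : Monomial → Monomial → Monomial
  lcm m k = (m ∖ k) ++ k

  ⊑-lcmʳ : ∀ {m k} → k ⊑ lcm m k
  ⊑-lcmʳ {m} {k} = mk⊑ λ a → ≡.subst (count a k ℕ.≤_) (≡.sym (count-++ a (m ∖ k) k)) (ℕP.m≤n+m _ _)

  ⊑-lcmˡ : ∀ {m k} → m ⊑ lcm m k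
  ⊑-lcmˡ {m} {k} = mk⊑ λ a → ≡.subst (count a m ℕ.≤_)
    (≡.sym (≡.trans (count-++ a (m ∖ k) k)
      (≡.trans (≡.cong (ℕ._+ count a k) (count-∖ a m k)) (ℕP.+-comm _ (count a k)))))
    (ℕP.m≤n+m∸n (count a m) (count a k))

  count-lcm : ∀ a m k → count a (lcm m k) ≡ count a m ⊎ count a (lcm m k) ≡ count a k
  count-lcm a m k with ℕP.≤-total (count a k) (count a m)
  ... | inj₁ p = inj₁ (≡.trans (count-++ a (m ∖ k) k)
                   (≡.trans (≡.cong (ℕ._+ count a k) (count-∖ a m k)) (ℕP.m∸n+n≡m p)))
  ... | inj₂ p = inj₂ (≡.trans (count-++ a (m ∖ k) k)
                   (≡.cong (ℕ._+ count a k) (≡.trans (count-∖ a m k) (ℕP.m≤n⇒m∸n≡0 p))))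

  ⊑-++ʳ : ∀ m {k} → k ⊑ m ++ k
  ⊑-++ʳ m {k} = mk⊑ λ a → ≡.subst (count a k ℕ.≤_) (≡.sym (count-++ a m k)) (ℕP.m≤n+m _ _)

  -- An injective renaming keeps exponents, and each exponent of the least common multiple is one of
  -- `m` or one of `k`.
  map-lcm-⊑ : ∀ {ι} → Injective _≡_ _≡_ ι → ∀ {m k n} → map ι m ⊑ n → map ι k ⊑ n → map ι (lcm m k) ⊑ n
  map-lcm-⊑ {ι} inj {m} {k} {n} p q = ⊑-on-map inj (lcm m k) λ {a} _ → bound a (count-lcm a m k)
    where
    bound : ∀ a → count a (lcm m k) ≡ count a m ⊎ count a (lcm m k) ≡ count a k →
            count a (lcm m k) ℕ.≤ count (ι a) n
    bound a (inj₁ e) = ≡.subst (ℕ._≤ _) (≡.trans (count-map inj a m) (≡.sym e)) (count-⊑ p (ι a))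
    bound a (inj₂ e) = ≡.subst (ℕ._≤ _) (≡.trans (count-map inj a k) (≡.sym e)) (count-⊑ q (ι a))

  -- Outside the finitely many variables of `m ++ m'` both exponents are 0, which is where `R 0 0`
  -- enters.
  ∀count? : ∀ {R : ℕ → ℕ → Set} → Decidable R → R 0 0 → ∀ m m' → Dec (∀ a → R (count a m) (count a m'))
  ∀count? {R} R? r₀ m m' = map′ to (λ h → All.tabulate (λ {a} _ → h a)) (All.all? (λ a → R? _ _) (m ++ m'))
    where
    to : All (λ a → R (count a m) (count a m')) (m ++ m') → ∀ a → R (count a m) (count a m')
    to h a with a ∈? (m ++ m')
    ... | yes a∈ = All.lookup h a∈
    ... | no a∉ = ≡.subst₂ R (≡.sym (∉⇒count≡0 m (a∉ ∘ ∈-++⁺ˡ))) (≡.sym (∉⇒count≡0 m' (a∉ ∘ ∈-++⁺ʳ m))) r₀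

  opaque
    _≈ₘ?_ : Decidable _≈ₘ_
    m ≈ₘ? m' = map′ mk≈ count-≈ (∀count? ℕP._≟_ refl m m')

  _⊑?_ : Decidable _⊑_
  m ⊑? m' = map′ mk⊑ count-⊑ (∀count? ℕ._≤?_ z≤n m m')

  count-filter-yes : ∀ {P : A → Set} (P? : ∀ a → Dec (P a)) {a} m → P a → count a (filter P? m) ≡ count a m
  count-filter-yes P? [] p = refl
  count-filter-yes P? {a} (x ∷ m) p with P? x
  ... | yes _ = ≡.cong (λ k → if does (a ≟A x) then ℕ.suc k else k) (count-filter-yes P? m p)
  ... | no ¬p = ≡.trans (count-filter-yes P? m p) (≡.sym (count-≢ m λ { refl → ¬p p }))

  count-filter-no : ∀ {P : A → Set} (P? : ∀ a → Dec (P a)) {a} m → ¬ P a → count a (filter P? m) ≡ 0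
  count-filter-no P? m ¬p = ∉⇒count≡0 (filter P? m) λ i → ¬p (proj₂ (∈-filter⁻ P? {xs = m} i))

  -- The lexicographic order on monomials and its well-foundedness.

  module MonomialOrder {_≺_ : A → A → Set} (wo : IsWellOrder _≺_) where

    infix 4 _<ₘ_ _≤ₘ_

    ≺-irrefl : ∀ a → ¬ (a ≺ a)
    ≺-irrefl = proj₁ wo

    ≺-trans : Transitive _≺_
    ≺-trans = proj₁ (proj₂ wo)

    ≺-connex : ∀ a b → a ≢ b → a ≺ b ⊎ b ≺ a
    ≺-connex = proj₁ (proj₂ (proj₂ wo))

    ≺-wf : WellFounded _≺_
    ≺-wf = proj₂ (proj₂ (proj₂ wo))

    ≺-asym : ∀ {a b} → a ≺ b → ¬ (b ≺ a)
    ≺-asym a≺b b≺a = ≺-irrefl _ (≺-trans a≺b b≺a)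

    _≺?_ : Decidable _≺_
    a ≺? b with a ≟A b
    ... | yes refl = no (≺-irrefl a)
    ... | no a≢b with ≺-connex a b a≢b
    ... | inj₁ a≺b = yes a≺b
    ... | inj₂ b≺a = no (≺-asym b≺a)

    -- Lexicographic comparison of exponents, the largest variable first.
    record _<ₘ_ (m m' : Monomial) : Set where
      constructor mk<
      field
        pivot : A
        below : count pivot m ℕ.< count pivot m'
        agree : ∀ b → pivot ≺ b → count b m ≡ count b m'

    _≤ₘ_ : Monomial → Monomial → Set
    m ≤ₘ m' = m <ₘ m' ⊎ m ≈ₘ m'

    <ₘ-respˡ : ∀ {m m' k} → m ≈ₘ m' → m <ₘ k → m' <ₘ k
    <ₘ-respˡ e (mk< a l h) =
      mk< a (≡.subst (ℕ._< _) (count-≈ e a) l) λ b p → ≡.trans (≡.sym (count-≈ e b)) (h b p)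

    <ₘ-respʳ : ∀ {m k k'} → k ≈ₘ k' → m <ₘ k → m <ₘ k'
    <ₘ-respʳ e (mk< a l h) = mk< a (≡.subst (_ ℕ.<_) (count-≈ e a) l) λ b p → ≡.trans (h b p) (count-≈ e b)

    ⊑⇒≮ₘ : ∀ {m m'} → m ⊑ m' → ¬ (m' <ₘ m)
    ⊑⇒≮ₘ e (mk< a l _) = ℕP.<-irrefl refl (ℕP.<-≤-trans l (count-⊑ e a))

    <ₘ-irrefl : ∀ {m m'} → m ≈ₘ m' → ¬ (m <ₘ m')
    <ₘ-irrefl e = ⊑⇒≮ₘ (≈ₘ⇒⊑ (≈ₘ-sym e))

    <ₘ-trans : Transitive _<ₘ_
    <ₘ-trans (mk< a l h) (mk< a' l' h') with a ≟A a'
    ... | yes refl = mk< a (ℕP.<-trans l l') λ b p → ≡.trans (h b p) (h' b p)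
    ... | no a≢a' with ≺-connex a a' a≢a'
    ... | inj₁ a≺a' = mk< a' (≡.subst (ℕ._< _) (≡.sym (h a' a≺a')) l')
                    λ b p → ≡.trans (h b (≺-trans a≺a' p)) (h' b p)
    ... | inj₂ a'≺a = mk< a (≡.subst (_ ℕ.<_) (h' a a'≺a) l)
                    λ b p → ≡.trans (h b p) (h' b (≺-trans a'≺a p))

    ≤ₘ-<ₘ-trans : ∀ {m m' k} → m ≤ₘ m' → m' <ₘ k → m <ₘ k
    ≤ₘ-<ₘ-trans (inj₁ l) l' = <ₘ-trans l l'
    ≤ₘ-<ₘ-trans (inj₂ e) l' = <ₘ-respˡ (≈ₘ-sym e) l'

    ++-monoʳ-<ₘ : ∀ t {m m'} → m <ₘ m' → t ++ m <ₘ t ++ m'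
    ++-monoʳ-<ₘ t {m} {m'} (mk< a l h) =
      mk< a (≡.subst₂ ℕ._<_ (≡.sym (count-++ a t m)) (≡.sym (count-++ a t m')) (ℕP.+-monoʳ-< (count a t) l))
        λ b p → ≡.trans (count-++ b t m)
                  (≡.trans (≡.cong (count b t ℕ.+_) (h b p)) (≡.sym (count-++ b t m')))

    -- A variable outside the image of `ι` has exponent 0 on both sides. On the image, agreement
    -- above the pivot needs `ι` to reflect the order, which a monotone map on a total order does.
    map-<ₘ : ∀ {ι} → Injective _≡_ _≡_ ι → (∀ {a b} → a ≺ b → ι a ≺ ι b) →
             ∀ {m m'} → m <ₘ m' → map ι m <ₘ map ι m'
    map-<ₘ {ι} inj mono {m} {m'} (mk< a l h) =
      mk< (ι a) (≡.subst₂ ℕ._<_ (≡.sym (count-map inj a m)) (≡.sym (count-map inj a m')) l) above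
      where
      reflect : ∀ {b} → ι a ≺ ι b → a ≺ b
      reflect {b} p with a ≟A b
      ... | yes refl = ⊥-elim (≺-irrefl _ p)
      ... | no a≢b with ≺-connex a b a≢b
      ... | inj₁ a≺b = a≺b
      ... | inj₂ b≺a = ⊥-elim (≺-asym p (mono b≺a))
      agree : ∀ b → ι a ≺ ι b → count (ι b) (map ι m) ≡ count (ι b) (map ι m')
      agree b p = ≡.trans (count-map inj b m) (≡.trans (h b (reflect p)) (≡.sym (count-map inj b m')))
      above : ∀ b → ι a ≺ b → count b (map ι m) ≡ count b (map ι m')
      above b p with b ∈? (map ι m ++ map ι m')
      ... | no b∉ = ≡.trans (∉⇒count≡0 (map ι m) (b∉ ∘ ∈-++⁺ˡ))
                            (≡.sym (∉⇒count≡0 (map ι m') (b∉ ∘ ∈-++⁺ʳ (map ι m))))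
      ... | yes b∈ with ∈-map⁻ ι (≡.subst (b ∈_) (≡.sym (map-++ ι m m')) b∈)
      ... | b' , _ , refl = agree b' p

    <ₘ-tri : ∀ m m' → m <ₘ m' ⊎ m ≈ₘ m' ⊎ m' <ₘ m
    -- The pivot is the greatest variable at which the exponents differ.
    <ₘ-tri m m' = by-cases
      (maximal ≺-irrefl ≺-trans _≺?_ (λ a → ¬? (count a m ℕP.≟ count a m')) (m ++ m'))
      where
      agree : ∀ a → (a ∈ m ++ m' → ¬ (count a m ≢ count a m')) → count a m ≡ count a m'
      agree a h with a ∈? (m ++ m')
      ... | yes a∈ = decidable-stable (_ ℕP.≟ _) (h a∈)
      ... | no a∉ = ≡.trans (∉⇒count≡0 m (a∉ ∘ ∈-++⁺ˡ)) (≡.sym (∉⇒count≡0 m' (a∉ ∘ ∈-++⁺ʳ m)))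
      by-cases : _ → m <ₘ m' ⊎ m ≈ₘ m' ⊎ m' <ₘ m
      by-cases (inj₁ h) = inj₂ (inj₁ (mk≈ λ a → agree a h))
      by-cases (inj₂ (a , a≢ , h)) with ℕP.<-cmp (count a m) (count a m')
      ... | tri< l _ _ = inj₁ (mk< a l λ b a≺b → agree b λ b∈ b≢ → h b∈ b≢ a≺b)
      ... | tri≈ _ e _ = ⊥-elim (a≢ e)
      ... | tri> _ _ l = inj₂ (inj₂ (mk< a l λ b a≺b → ≡.sym (agree b λ b∈ b≢ → h b∈ b≢ a≺b)))

    ⊑⇒≤ₘ : ∀ {m m'} → m ⊑ m' → m ≤ₘ m'
    ⊑⇒≤ₘ {m} {m'} e with <ₘ-tri m m'
    ... | inj₁ l = inj₁ l
    ... | inj₂ (inj₁ e') = inj₂ e'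
    ... | inj₂ (inj₂ l) = ⊥-elim (⊑⇒≮ₘ e l)

    <ₘ-acc-≤ₘ : ∀ {m m'} → m ≤ₘ m' → Acc _<ₘ_ m' → Acc _<ₘ_ m
    <ₘ-acc-≤ₘ (inj₁ l) (acc rs) = rs l
    <ₘ-acc-≤ₘ (inj₂ e) (acc rs) = acc λ l → rs (<ₘ-respʳ e l)

    <ₘ-acc-++ : ∀ {a} → (∀ {b} → b ≺ a → ∀ {m} → Acc _<ₘ_ m → Acc _<ₘ_ (b ∷ m)) →
                ∀ {k m} → All (_≺ a) k → Acc _<ₘ_ m → Acc _<ₘ_ (k ++ m)
    <ₘ-acc-++ H [] h = h
    <ₘ-acc-++ H (b≺a ∷ k≺a) h = H b≺a (<ₘ-acc-++ H k≺a h)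

    -- If a does not occur in a predecessor m' of a m, then m' consists of a part below a
    -- and of a part above a that divides m or is smaller than m.
    <ₘ-acc-∷-step : ∀ {a} → (∀ {b} → b ≺ a → ∀ {m} → Acc _<ₘ_ m → Acc _<ₘ_ (b ∷ m)) →
                    ∀ {m} → Acc _<ₘ_ m → Acc _<ₘ_ (a ∷ m)
    <ₘ-acc-∷-step {a} H {m} (acc rsₘ) = acc pred
      where
      count-above : ∀ {b} → a ≺ b → count b (a ∷ m) ≡ count b m
      count-above a≺b = count-≢ m λ { refl → ≺-irrefl _ a≺b }
      pred : ∀ {m'} → m' <ₘ a ∷ m → Acc _<ₘ_ m'
      pred {m'} (mk< b l h) = by-cases (a ∈? m')
        where
        by-cases : Dec (a ∈ m') → Acc _<ₘ_ m'
        -- Cancelling one `a` on both sides of `m' <ₘ a ∷ m` leaves `k <ₘ m`, so the recursion is on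
        -- the accessibility of `m`.
        by-cases (yes a∈) = <ₘ-acc-≤ₘ (inj₂ (≈ₘ-sym split)) (<ₘ-acc-∷-step H (rsₘ smaller))
          where
          k = m' ∖ (a ∷ [])
          split : a ∷ k ≈ₘ m'
          split = ≈ₘ-trans (mk≈ λ c → ≡.trans (count-++ c (a ∷ []) k)
                              (≡.trans (ℕP.+-comm (count c (a ∷ [])) _) (≡.sym (count-++ c k (a ∷ [])))))
                    (∖-++ (mk⊑ λ c → one c))
            where
            one : ∀ c → count c (a ∷ []) ℕ.≤ count c m'
            one c with c ≟A a
            ... | yes refl = ∈⇒0<count m' a∈
            ... | no _ = z≤n
          cancel : ∀ c → (k' m'' : Monomial) → count c (a ∷ k') ≡ count c (a ∷ m'') → count c k' ≡ count c m''
          cancel c k' m'' with c ≟A a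
          ... | yes _ = ℕP.suc-injective
          ... | no _ = id
          cancel< : ∀ c → (k' m'' : Monomial) → count c (a ∷ k') ℕ.< count c (a ∷ m'') → count c k' ℕ.< count c m''
          cancel< c k' m'' with c ≟A a
          ... | yes _ = ℕ.s<s⁻¹
          ... | no _ = id
          smaller : k <ₘ m
          smaller = mk< b (cancel< b k m (≡.subst (ℕ._< _) (≡.sym (count-≈ split b)) l))
                      λ c p → cancel c k m (≡.trans (count-≈ split c) (h c p))
        by-cases (no a∉) = <ₘ-acc-≤ₘ (inj₂ (≈ₘ-sym split))
                        (<ₘ-acc-++ H (AllP.all-filter (_≺? a) m')
                          (<ₘ-acc-≤ₘ high≤m (acc rsₘ)))
          where
          low = filter (_≺? a) m'
          high = filter (a ≺?_) m'
          -- A pivot below `a` would force `m'` to contain `a` as often as `a ∷ m` does.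
          a≼b : ¬ (b ≺ a)
          a≼b b≺a = ℕP.0≢1+n (≡.trans (≡.sym (∉⇒count≡0 m' a∉)) (≡.trans (h a b≺a) (count-≡ a m)))
          split : low ++ high ≈ₘ m'
          split = mk≈ λ c → ≡.trans (count-++ c low high) (parts c)
            where
            parts : ∀ c → count c low ℕ.+ count c high ≡ count c m'
            parts c with c ≟A a
            ... | yes refl = ≡.trans (≡.cong₂ ℕ._+_ (count-filter-no (_≺? a) m' (≺-irrefl a))
                               (count-filter-no (a ≺?_) m' (≺-irrefl a))) (≡.sym (∉⇒count≡0 m' a∉))
            ... | no c≢a with ≺-connex c a c≢a
            ... | inj₁ c≺a = ≡.trans (≡.cong₂ ℕ._+_ (count-filter-yes (_≺? a) m' c≺a)
                               (count-filter-no (a ≺?_) m' (≺-asym c≺a))) (ℕP.+-identityʳ _)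
            ... | inj₂ a≺c = ≡.cong₂ ℕ._+_ (count-filter-no (_≺? a) m' (≺-asym a≺c))
                               (count-filter-yes (a ≺?_) m' a≺c)
          high≤m : high ≤ₘ m
          high≤m = by-pivot (b ≟A a)
            where
            by-pivot : Dec (b ≡ a) → high ≤ₘ m
            -- With pivot `a`, the part above `a` has the exponents of `m` there and nothing else,
            -- so it divides `m`. A pivot above `a` also witnesses that this part is smaller than
            -- `m`.
            by-pivot (yes refl) = ⊑⇒≤ₘ (mk⊑ λ c → bound c (a ≺? c))
              where
              bound : ∀ c → Dec (a ≺ c) → count c high ℕ.≤ count c m
              bound c (yes a≺c) = ℕP.≤-reflexive
                (≡.trans (count-filter-yes (a ≺?_) m' a≺c) (≡.trans (h c a≺c) (count-above a≺c)))
              bound c (no a⊀c) = ≡.subst (ℕ._≤ _) (≡.sym (count-filter-no (a ≺?_) m' a⊀c)) z≤n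
            by-pivot (no b≢a) with ≺-connex b a b≢a
            ... | inj₁ b≺a = ⊥-elim (a≼b b≺a)
            ... | inj₂ a≺b = inj₁ (mk< b
                (≡.subst₂ ℕ._<_ (≡.sym (count-filter-yes (a ≺?_) m' a≺b)) (count-above a≺b) l)
                λ c b≺c → ≡.trans (count-filter-yes (a ≺?_) m' (≺-trans a≺b b≺c))
                            (≡.trans (h c b≺c) (count-above (≺-trans a≺b b≺c))))

    -- Two nested inductions: the outer one on the variable `a`, the inner one, in `<ₘ-acc-∷-step`,
    -- on the monomial.
    <ₘ-acc-∷ : ∀ {a} → Acc _≺_ a → ∀ {m} → Acc _<ₘ_ m → Acc _<ₘ_ (a ∷ m)
    <ₘ-acc-∷ (acc rs) = <ₘ-acc-∷-step λ b≺a → <ₘ-acc-∷ (rs b≺a)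

    <ₘ-wf : WellFounded _<ₘ_
    <ₘ-wf [] = acc λ ()
    <ₘ-wf (a ∷ m) = <ₘ-acc-∷ (≺-wf a) (<ₘ-wf m)

-- Polynomials up to equality of coefficients.

module Polynomials {c ℓ : Level} (K : ComputableField c ℓ) (D : Domain)
                   {_≺_ : Domain.A D → Domain.A D → Set} (wo : IsWellOrder _≺_) where
  open ComputableField K using (Carrier; _≈_; _+_; _*_; -_; 0#; 1#; 1≉0; inverse; _≟_; setoid;
      +-cong; +-congˡ; +-congʳ; *-cong; *-congˡ; *-congʳ; +-identityˡ; +-identityʳ; +-assoc; +-comm;
      *-identityˡ; *-identityʳ; *-assoc; zeroˡ; zeroʳ; distribˡ; -‿inverseʳ;
      ring; commutativeSemiring)
    renaming (refl to ≈-refl; sym to ≈-sym; trans to ≈-trans; reflexive to ≈-reflexive)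
  open Domain D
  open Poly K D using (Pol; coeff; _≃_; rename; _*P_; sameMon; Summand; evalSum; InEqIdeal)
  open Monomials _≟A_ public
  open MonomialOrder wo public
  open import Algebra.Properties.Ring ring using (-1*x≈-x)
  open import Algebra.Solver.Ring.NaturalCoefficients.Default commutativeSemiring using (solve; _:+_; _:*_; _:=_)
  open import Relation.Binary.Reasoning.Setoid setoid

  Respects : (Monomial → Carrier) → Set ℓ
  Respects φ = ∀ {m m'} → m ≈ₘ m' → φ m ≈ φ m'

  eval : (Monomial → Carrier) → Pol → Carrier
  eval φ [] = 0#
  eval φ ((c , m) ∷ p) = c * φ m + eval φ p

  -- Equality under all linear functionals on the space of monomials: this makes congruence of
  -- the operations on polynomials immediate, and it follows from equality of coefficients (≃⇒≈ₚ).
  infix 4 _≈ₚ_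
  record _≈ₚ_ (p q : Pol) : Set (c ⊔ ℓ) where
    constructor mk≈ₚ
    field eval-≈ : ∀ φ → Respects φ → eval φ p ≈ eval φ q
  open _≈ₚ_ public

  ≈ₚ-refl : ∀ {p} → p ≈ₚ p
  ≈ₚ-refl = mk≈ₚ λ _ _ → ≈-refl

  ≈ₚ-reflexive : ∀ {p q} → p ≡ q → p ≈ₚ q
  ≈ₚ-reflexive refl = ≈ₚ-refl

  ≈ₚ-sym : ∀ {p q} → p ≈ₚ q → q ≈ₚ p
  ≈ₚ-sym e = mk≈ₚ λ φ r → ≈-sym (eval-≈ e φ r)

  ≈ₚ-trans : ∀ {p q s} → p ≈ₚ q → q ≈ₚ s → p ≈ₚ s
  ≈ₚ-trans e e' = mk≈ₚ λ φ r → ≈-trans (eval-≈ e φ r) (eval-≈ e' φ r)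

  eval-++ : ∀ φ p q → eval φ (p ++ q) ≈ eval φ p + eval φ q
  eval-++ φ [] q = ≈-sym (+-identityˡ _)
  eval-++ φ (t ∷ p) q = ≈-trans (+-congˡ (eval-++ φ p q)) (≈-sym (+-assoc _ _ _))

  eval-cong : ∀ {φ ψ} → (∀ m → φ m ≈ ψ m) → ∀ p → eval φ p ≈ eval ψ p
  eval-cong h [] = ≈-refl
  eval-cong h (t ∷ p) = +-cong (*-congˡ (h _)) (eval-cong h p)

  ++-cong : ∀ {p p' q q'} → p ≈ₚ p' → q ≈ₚ q' → p ++ q ≈ₚ p' ++ q'
  ++-cong {p} {p'} {q} {q'} e e' = mk≈ₚ λ φ r →
    ≈-trans (eval-++ φ p q) (≈-trans (+-cong (eval-≈ e φ r) (eval-≈ e' φ r)) (≈-sym (eval-++ φ p' q')))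

  -- Renaming by `ι` followed by multiplication with the term `c t`. Every summand of an ideal
  -- element splits into such pieces, and by `act-act` they are closed under composition.
  act : Carrier → Monomial → (A → A) → Pol → Pol
  act c t ι = map λ u → c * proj₁ u , t ++ map ι (proj₂ u)

  eval-act : ∀ φ c t ι p → eval φ (act c t ι p) ≈ c * eval (λ m → φ (t ++ map ι m)) p
  eval-act φ c t ι [] = ≈-sym (zeroʳ c)
  eval-act φ c t ι ((d , m) ∷ p) = begin
    c * d * x + eval φ (act c t ι p)  ≈⟨ +-cong (*-assoc c d x) (eval-act φ c t ι p) ⟩
    c * (d * x) + c * y               ≈⟨ distribˡ c (d * x) y ⟨
    c * (d * x + y)                   ∎
    where
    x = φ (t ++ map ι m)
    y = eval (λ m → φ (t ++ map ι m)) p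

  act-cong : ∀ {c t ι p q} → Injective _≡_ _≡_ ι → p ≈ₚ q → act c t ι p ≈ₚ act c t ι q
  act-cong {c} {t} {ι} {p} {q} inj e = mk≈ₚ λ φ r → begin
    eval φ (act c t ι p)                   ≈⟨ eval-act φ c t ι p ⟩
    c * eval (λ m → φ (t ++ map ι m)) p    ≈⟨ *-congˡ (eval-≈ e _ λ e' → r (++-cong-≈ₘ ≈ₘ-refl (map-≈ₘ inj e'))) ⟩
    c * eval (λ m → φ (t ++ map ι m)) q    ≈⟨ eval-act φ c t ι q ⟨
    eval φ (act c t ι q)                   ∎

  act-cong-coeff : ∀ {c c' t t' ι p} → c ≈ c' → t ≈ₘ t' → act c t ι p ≈ₚ act c' t' ι p
  act-cong-coeff {c} {c'} {t} {t'} {ι} {p} e e' = mk≈ₚ λ φ r → begin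
    eval φ (act c t ι p)                    ≈⟨ eval-act φ c t ι p ⟩
    c * eval (λ m → φ (t ++ map ι m)) p     ≈⟨ *-cong e (eval-cong (λ m → r (++-cong-≈ₘ e' ≈ₘ-refl)) p) ⟩
    c' * eval (λ m → φ (t' ++ map ι m)) p   ≈⟨ eval-act φ c' t' ι p ⟨
    eval φ (act c' t' ι p)                  ∎

  act-act : ∀ c t κ d s ι p → act c t κ (act d s ι p) ≈ₚ act (c * d) (t ++ map κ s) (κ ∘ ι) p
  act-act c t κ d s ι p = mk≈ₚ λ φ r → begin
    eval φ (act c t κ (act d s ι p))
      ≈⟨ eval-act φ c t κ (act d s ι p) ⟩
    c * eval (λ m → φ (t ++ map κ m)) (act d s ι p)
      ≈⟨ *-congˡ (eval-act _ d s ι p) ⟩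
    c * (d * eval (λ m → φ (t ++ map κ (s ++ map ι m))) p)
      ≈⟨ *-assoc c d _ ⟨
    c * d * eval (λ m → φ (t ++ map κ (s ++ map ι m))) p
      ≈⟨ *-congˡ (eval-cong (λ m → ≈-reflexive (≡.cong φ (mon m))) p) ⟩
    c * d * eval (λ m → φ ((t ++ map κ s) ++ map (κ ∘ ι) m)) p
      ≈⟨ eval-act φ (c * d) (t ++ map κ s) (κ ∘ ι) p ⟨
    eval φ (act (c * d) (t ++ map κ s) (κ ∘ ι) p) ∎
    where
    mon : ∀ m → t ++ map κ (s ++ map ι m) ≡ (t ++ map κ s) ++ map (κ ∘ ι) m
    mon m = ≡.trans (≡.cong (t ++_) (≡.trans (map-++ κ s (map ι m)) (≡.cong (map κ s ++_) (≡.sym (map-∘ m)))))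
                    (≡.sym (++-assoc t (map κ s) (map (κ ∘ ι) m)))

  act-++ : ∀ c t ι p q → act c t ι (p ++ q) ≡ act c t ι p ++ act c t ι q
  act-++ c t ι p q = map-++ _ p q

  scale : Carrier → Pol → Pol
  scale c = act c [] id

  eval-scale : ∀ φ c p → eval φ (scale c p) ≈ c * eval φ p
  eval-scale φ c p = ≈-trans (eval-act φ c [] id p)
    (*-congˡ (eval-cong (λ m → ≈-reflexive (≡.cong φ (map-id m))) p))

  scale-1 : ∀ {c} → c ≈ 1# → ∀ p → scale c p ≈ₚ p
  scale-1 {c} e p = mk≈ₚ λ φ r → ≈-trans (eval-scale φ c p) (≈-trans (*-congʳ e) (*-identityˡ _))

  eval-scale-+ : ∀ φ a p q → eval φ (scale a p ++ q) ≈ a * eval φ p + eval φ q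
  eval-scale-+ φ a p q = ≈-trans (eval-++ φ (scale a p) q) (+-congʳ (eval-scale φ a p))

  -- Extended linearly, `δ m` is the functional that extracts the coefficient at `m`; see
  -- `coeff≈eval`.
  δ : Monomial → Monomial → Carrier
  δ m m' = if does (m ≈ₘ? m') then 1# else 0#

  δ-≈ : ∀ {m m'} → m ≈ₘ m' → δ m m' ≈ 1#
  δ-≈ {m} {m'} e rewrite dec-true (m ≈ₘ? m') e = ≈-refl

  δ-≉ : ∀ {m m'} → ¬ (m ≈ₘ m') → δ m m' ≈ 0#
  δ-≉ {m} {m'} ¬e rewrite dec-false (m ≈ₘ? m') ¬e = ≈-refl

  δ-respects : ∀ m → Respects (δ m)
  δ-respects m {k} {k'} e with m ≈ₘ? k
  ... | yes e' = ≈-sym (δ-≈ (≈ₘ-trans e' e))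
  ... | no ¬e' = ≈-sym (δ-≉ λ e' → ¬e' (≈ₘ-trans e' (≈ₘ-sym e)))

  opaque
    unfolding _≈ₘ?_
    sameMon-does : ∀ m m' → sameMon m m' ≡ does (m ≈ₘ? m')
    sameMon-does m m' = go (m ++ m')
      where
      go : ∀ L → foldr (λ a b → does (count a m ℕP.≟ count a m') ∧ b) true L
               ≡ does (All.all? (λ a → count a m ℕP.≟ count a m') L)
      go [] = refl
      go (x ∷ L) = ≡.cong (does (count x m ℕP.≟ count x m') ∧_) (go L)

  coeff≈eval : ∀ p m → coeff p m ≈ eval (δ m) p
  coeff≈eval [] m = ≈-refl
  coeff≈eval ((c , m') ∷ p) m rewrite sameMon-does m m' with m ≈ₘ? m'
  ... | yes _ = +-cong (≈-sym (*-identityʳ c)) (coeff≈eval p m)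
  ... | no _ = ≈-trans (coeff≈eval p m) (≈-sym (≈-trans (+-congʳ (zeroʳ c)) (+-identityˡ _)))

  ≈ₚ⇒≃ : ∀ {p q} → p ≈ₚ q → p ≃ q
  ≈ₚ⇒≃ {p} {q} e m =
    ≈-trans (coeff≈eval p m) (≈-trans (eval-≈ e (δ m) (δ-respects m)) (≈-sym (coeff≈eval q m)))

  AllMon : (Monomial → Set) → Pol → Set c
  AllMon P = All (P ∘ proj₂)

  eval-δ-≈0 : ∀ {m p} → AllMon (λ m' → ¬ (m ≈ₘ m')) p → eval (δ m) p ≈ 0#
  eval-δ-≈0 [] = ≈-refl
  eval-δ-≈0 {m} {(c , m') ∷ p} (¬e ∷ h) = begin
    c * δ m m' + eval (δ m) p ≈⟨ +-cong (*-congˡ (δ-≉ ¬e)) (eval-δ-≈0 h) ⟩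
    c * 0# + 0#               ≈⟨ +-identityʳ _ ⟩
    c * 0#                    ≈⟨ zeroʳ c ⟩
    0#                        ∎

  eval-δ-head : ∀ {c m p} → AllMon (_<ₘ m) p → eval (δ m) ((c , m) ∷ p) ≈ c
  eval-δ-head {c} {m} {p} h = begin
    c * δ m m + eval (δ m) p
      ≈⟨ +-cong (*-congˡ (δ-≈ (≈ₘ-refl {m}))) (eval-δ-≈0 (All.map (λ l e → <ₘ-irrefl (≈ₘ-sym e) l) h)) ⟩
    c * 1# + 0#  ≈⟨ +-identityʳ _ ⟩
    c * 1#       ≈⟨ *-identityʳ c ⟩
    c            ∎

  -- Normal forms: strictly decreasing monomials, nonzero coefficients.

  data Normal : Pol → Set (c ⊔ ℓ) where
    []   : Normal []
    cons : ∀ {c m p} → ¬ (c ≈ 0#) → AllMon (_<ₘ m) p → Normal p → Normal ((c , m) ∷ p)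

  -- Through arbitrary predicates, `nf-mon` says that normalising introduces no new monomials.
  -- Bounds on the terms of `p` thus pass to its leading monomial.
  record NormalForm (p : Pol) : Set (Level.suc Level.zero ⊔ c ⊔ ℓ) where
    constructor mkNf
    field
      nf     : Pol
      normal : Normal nf
      nf≈    : p ≈ₚ nf
      nf-mon : ∀ {P : Monomial → Set} → AllMon P p → AllMon P nf

  ∷-congₚ : ∀ {t p q} → p ≈ₚ q → t ∷ p ≈ₚ t ∷ q
  ∷-congₚ e = mk≈ₚ λ φ r → +-congˡ (eval-≈ e φ r)

  0∷ : ∀ {c m p} → c ≈ 0# → (c , m) ∷ p ≈ₚ p
  0∷ e = mk≈ₚ λ φ r → ≈-trans (+-congʳ (≈-trans (*-congʳ e) (zeroˡ _))) (+-identityˡ _)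

  merge : ∀ {c m c' m' p} → m ≈ₘ m' → (c , m) ∷ (c' , m') ∷ p ≈ₚ (c + c' , m') ∷ p
  merge m≈m' = mk≈ₚ λ φ r → ≈-trans (+-congʳ (*-congˡ (r m≈m')))
    (solve 4 (λ x y z w → x :* z :+ (y :* z :+ w) := (x :+ y) :* z :+ w) ≈-refl _ _ _ _)

  insert : ∀ c m {p} → Normal p → NormalForm ((c , m) ∷ p)
  insert c m {p} np with c ≟ 0#
  ... | yes c≈0 = mkNf p np (0∷ c≈0) All.tail
  insert c m [] | no c≉0 = mkNf _ (cons c≉0 [] []) ≈ₚ-refl id
  insert c m (cons {c'} {m'} {p} c'≉0 h np) | no c≉0 with <ₘ-tri m m'
  ... | inj₁ m<m' = let mkNf q nq e hq = insert c m np in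
    mkNf ((c' , m') ∷ q) (cons c'≉0 (hq (m<m' ∷ h)) nq)
      (mk≈ₚ λ φ r → ≈-trans (solve 3 (λ x y z → x :+ (y :+ z) := y :+ (x :+ z)) ≈-refl _ _ _)
                            (+-congˡ (eval-≈ e φ r)))
      λ { (a ∷ b ∷ d) → b ∷ hq (a ∷ d) }
  ... | inj₂ (inj₂ m'<m) =
    mkNf ((c , m) ∷ (c' , m') ∷ p) (cons c≉0 (m'<m ∷ All.map (λ l → <ₘ-trans l m'<m) h) (cons c'≉0 h np))
      ≈ₚ-refl id
  ... | inj₂ (inj₁ m≈m') with (c + c') ≟ 0#
  ... | yes c+c'≈0 = mkNf p np (≈ₚ-trans (merge m≈m') (0∷ c+c'≈0)) λ { (a ∷ b ∷ d) → d }
  ... | no c+c'≉0 = mkNf ((c + c' , m') ∷ p) (cons c+c'≉0 h np) (merge m≈m') λ { (a ∷ b ∷ d) → b ∷ d }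

  normalize : ∀ p → NormalForm p
  normalize [] = mkNf [] [] ≈ₚ-refl id
  normalize ((c , m) ∷ p) =
    let mkNf q nq e hq = normalize p
        mkNf s ns e' hs = insert c m nq
    in mkNf s ns (≈ₚ-trans (∷-congₚ e) e') λ { (a ∷ b) → hs (a ∷ hq b) }

  x-y≈0⇒x≈y : ∀ {x y} → x + - 1# * y ≈ 0# → x ≈ y
  x-y≈0⇒x≈y {x} {y} e = begin
    x                   ≈⟨ +-identityʳ x ⟨
    x + 0#              ≈⟨ +-congˡ (-‿inverseʳ y) ⟨
    x + (y + - y)       ≈⟨ +-congˡ (+-congˡ (-1*x≈-x y)) ⟨
    x + (y + - 1# * y)  ≈⟨ solve 3 (λ x y z → x :+ (y :+ z) := (x :+ z) :+ y) ≈-refl x y (- 1# * y) ⟩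
    x + - 1# * y + y    ≈⟨ +-congʳ e ⟩
    0# + y              ≈⟨ +-identityˡ y ⟩
    y                   ∎

  x-x≈0 : ∀ x → x + - 1# * x ≈ 0#
  x-x≈0 x = ≈-trans (+-congˡ (-1*x≈-x x)) (-‿inverseʳ x)

  -- A nonempty normal form of the difference would have a nonzero leading coefficient, visible as a
  -- difference of coefficients at that monomial. So the normal form is empty, and every functional
  -- vanishes on it.
  ≃⇒≈ₚ : ∀ {p q} → p ≃ q → p ≈ₚ q
  ≃⇒≈ₚ {p} {q} e with normalize (p ++ scale (- 1#) q)
  ... | mkNf [] _ e' _ = mk≈ₚ λ φ r → x-y≈0⇒x≈y (begin
    eval φ p + - 1# * eval φ q            ≈⟨ +-congˡ (eval-scale φ (- 1#) q) ⟨
    eval φ p + eval φ (scale (- 1#) q)    ≈⟨ eval-++ φ p (scale (- 1#) q) ⟨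
    eval φ (p ++ scale (- 1#) q)          ≈⟨ eval-≈ e' φ r ⟩
    0# ∎)
  ... | mkNf ((c , m) ∷ s) (cons c≉0 h _) e' _ = ⊥-elim (c≉0 (begin
    c                                            ≈⟨ eval-δ-head h ⟨
    eval (δ m) ((c , m) ∷ s)                     ≈⟨ eval-≈ e' (δ m) (δ-respects m) ⟨
    eval (δ m) (p ++ scale (- 1#) q)             ≈⟨ eval-++ (δ m) p _ ⟩
    eval (δ m) p + eval (δ m) (scale (- 1#) q)   ≈⟨ +-congˡ (eval-scale (δ m) (- 1#) q) ⟩
    eval (δ m) p + - 1# * eval (δ m) q
      ≈⟨ +-congʳ (≈-trans (≈-sym (coeff≈eval p m)) (≈-trans (e m) (coeff≈eval q m))) ⟩
    eval (δ m) q + - 1# * eval (δ m) q           ≈⟨ x-x≈0 (eval (δ m) q) ⟩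
    0# ∎))

  -- Spans: sums of renamed term multiples, with a side condition on each summand.

  data Span {x y} {X : Set x} (pol : X → Pol) (adm : X → Monomial → (A → A) → Set y) :
            Pol → Set (c ⊔ ℓ ⊔ x ⊔ y) where
    nil : ∀ {p} → p ≈ₚ [] → Span pol adm p
    add : ∀ {p r} c t ι x → IsEmb ι → adm x t ι → p ≈ₚ act c t ι (pol x) ++ r →
          Span pol adm r → Span pol adm p

  module _ {x y} {X : Set x} {pol : X → Pol} {adm : X → Monomial → (A → A) → Set y} where

    span-resp : ∀ {p q} → p ≈ₚ q → Span pol adm p → Span pol adm q
    span-resp e (nil e') = nil (≈ₚ-trans (≈ₚ-sym e) e')
    span-resp e (add c t ι x ι-emb a e' s) = add c t ι x ι-emb a (≈ₚ-trans (≈ₚ-sym e) e') s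

    span-++ : ∀ {p q} → Span pol adm p → Span pol adm q → Span pol adm (p ++ q)
    span-++ {q = q} (nil e) s' = span-resp (≈ₚ-sym (++-cong e (≈ₚ-refl {q}))) s'
    span-++ {q = q} (add {r = r} c t ι x ι-emb a e s) s' =
      add c t ι x ι-emb a (≈ₚ-trans (++-cong e ≈ₚ-refl) (≈ₚ-reflexive (++-assoc (act c t ι (pol x)) r q)))
        (span-++ s s')

    span-gen : ∀ {c t ι x} → IsEmb ι → adm x t ι → Span pol adm (act c t ι (pol x))
    span-gen ι-emb a = add _ _ _ _ ι-emb a (≈ₚ-reflexive (≡.sym (++-identityʳ _))) (nil ≈ₚ-refl)

    span-act : ∀ {adm' : X → Monomial → (A → A) → Set y} {c t κ} → IsEmb κ →
               (∀ {x s ι} → adm x s ι → adm' x (t ++ map κ s) (κ ∘ ι)) →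
               ∀ {p} → Span pol adm p → Span pol adm' (act c t κ p)
    span-act κ-emb h (nil e) = nil (act-cong (proj₁ κ-emb) e)
    span-act {c = c} {t} {κ} κ-emb h (add {r = r} d s ι x ι-emb a e p) =
      add (c * d) (t ++ map κ s) (κ ∘ ι) x (Embeddings.∘-emb D κ-emb ι-emb) (h a)
        (≈ₚ-trans (act-cong (proj₁ κ-emb) e)
          (≈ₚ-trans (≈ₚ-reflexive (act-++ c t κ (act d s ι (pol x)) r))
            (++-cong (act-act c t κ d s ι (pol x)) ≈ₚ-refl)))
        (span-act κ-emb h p)

    span-scale : ∀ {c p} → Span pol adm p → Span pol adm (scale c p)
    span-scale = span-act (Embeddings.id-emb D) λ {x} {s} {ι} → ≡.subst (λ s → adm x s ι) (≡.sym (map-id s))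

    -- As `c` is invertible, `p` can be solved for. This is how a remainder is seen to lie in the
    -- span of the dividend and the basis.
    span-combination⁻ : ∀ {c p q f} → ¬ (c ≈ 0#) → f ≈ₚ scale c p ++ q →
                        Span pol adm f → Span pol adm q → Span pol adm p
    span-combination⁻ {c} {p} {q} {f} c≉0 e sf sq =
      span-resp solved (span-scale {c = c⁻¹} (span-++ sf (span-scale {c = - 1#} sq)))
      where
      c⁻¹ = proj₁ (inverse c c≉0)
      solved : scale c⁻¹ (f ++ scale (- 1#) q) ≈ₚ p
      solved = mk≈ₚ λ φ r → begin
        eval φ (scale c⁻¹ (f ++ scale (- 1#) q))
          ≈⟨ eval-scale φ c⁻¹ (f ++ scale (- 1#) q) ⟩
        c⁻¹ * eval φ (f ++ scale (- 1#) q)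
          ≈⟨ *-congˡ (≈-trans (eval-++ φ f _) 
             (+-cong (≈-trans (eval-≈ e φ r) (eval-scale-+ φ c p q)) (eval-scale φ (- 1#) q))) ⟩
        c⁻¹ * (c * eval φ p + eval φ q + - 1# * eval φ q)
          ≈⟨ *-congˡ (≈-trans (+-assoc _ _ _) (≈-trans (+-congˡ (x-x≈0 (eval φ q))) (+-identityʳ _))) ⟩
        c⁻¹ * (c * eval φ p)
          ≈⟨ solve 3 (λ x y z → x :* (y :* z) := (y :* x) :* z) ≈-refl c⁻¹ c (eval φ p) ⟩
        c * c⁻¹ * eval φ p
          ≈⟨ *-congʳ (proj₂ (inverse c c≉0)) ⟩
        1# * eval φ p
          ≈⟨ *-identityˡ _ ⟩
        eval φ p ∎

  span-bind : ∀ {x y} {X : Set x} {pol : X → Pol} {adm : X → Monomial → (A → A) → Set y}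
              {x' y'} {X' : Set x'} {pol' : X' → Pol} {adm' : X' → Monomial → (A → A) → Set y'} →
              (∀ {c t ι x} → IsEmb ι → adm x t ι → Span pol' adm' (act c t ι (pol x))) →
              ∀ {p} → Span pol adm p → Span pol' adm' p
  span-bind h (nil e) = nil e
  span-bind h (add c t ι x ι-emb a e s) = span-resp (≈ₚ-sym e) (span-++ (h ι-emb a) (span-bind h s))

  ideal⇒span : ∀ {f 𝓑} → InEqIdeal f 𝓑 → Span id (λ b _ _ → b ∈ 𝓑) f
  ideal⇒span {f} {𝓑} (ss , e) = span-resp (≈ₚ-sym (≃⇒≈ₚ e)) (sum ss)
    where
    product : ∀ h {ι g} → IsEmb ι → g ∈ 𝓑 → Span id (λ b _ _ → b ∈ 𝓑) (h *P rename ι g)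
    product [] ι-emb g∈ = nil ≈ₚ-refl
    product ((c , t) ∷ h) {ι} {g} ι-emb g∈ = span-++
      (span-resp (≈ₚ-reflexive (map-∘ g)) (span-gen {c = c} {t} ι-emb g∈)) (product h ι-emb g∈)
    sum : ∀ ss → Span id (λ b _ _ → b ∈ 𝓑) (evalSum {𝓑} ss)
    sum [] = nil ≈ₚ-refl
    sum (s ∷ ss) = span-++ (product (Summand.h s) (Summand.ι-emb s) (Summand.g∈𝓑 s)) (sum ss)

  span⇒ideal : ∀ {f 𝓑} → Span id (λ b _ _ → b ∈ 𝓑) f → InEqIdeal f 𝓑
  span⇒ideal {f} {𝓑} s = let ss , e = go s in ss , ≈ₚ⇒≃ e
    where
    go : ∀ {f} → Span id (λ b _ _ → b ∈ 𝓑) f → Σ (List (Summand 𝓑)) λ ss → f ≈ₚ evalSum ss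
    go (nil e) = [] , e
    go (add c t ι g ι-emb g∈ e s) =
      let ss , e' = go s in
        record { h = (c , t) ∷ [] ; ι = ι ; ι-emb = ι-emb ; g = g ; g∈𝓑 = g∈ } ∷ ss
      , ≈ₚ-trans e (++-cong (≈ₚ-reflexive (≡.trans (map-∘ g) (≡.sym (++-identityʳ _)))) e')

  -- Leading coefficient 1 keeps reduction steps and S-polynomials free of inverses. The tail may be
  -- any formal sum of terms below `lm`.
  record Monic : Set c where
    constructor monic
    field
      lm    : Monomial
      tail  : Pol
      tail< : AllMon (_<ₘ lm) tail

    pol : Pol
    pol = (1# , lm) ∷ tail
  open Monic public

  eval-act-monic : ∀ φ c t ι g → eval φ (act c t ι (pol g))
                 ≈ c * φ (t ++ map ι (lm g)) + c * eval (λ m → φ (t ++ map ι m)) (tail g)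
  eval-act-monic φ c t ι g = ≈-trans (eval-act φ c t ι (pol g))
    (≈-trans (*-congˡ (+-congʳ (*-identityˡ _))) (distribˡ c _ _))

  eval-δ-lm : ∀ g → eval (δ (lm g)) (pol g) ≈ 1#
  eval-δ-lm g = eval-δ-head (tail< g)

  record Leading (f : Pol) : Set (Level.suc Level.zero ⊔ c ⊔ ℓ) where
    constructor leads
    field
      {lc} : Carrier
      lc≉0 : ¬ (lc ≈ 0#)
      top  : Monic
      eqn  : f ≈ₚ scale lc (pol top)
      lm∈  : ∀ {P : Monomial → Set} → AllMon P f → P (lm top)

  AllMon-act : ∀ {P Q : Monomial → Set} {c t ι} → (∀ {m} → P m → Q (t ++ map ι m)) →
               ∀ {p} → AllMon P p → AllMon Q (act c t ι p)
  AllMon-act h [] = []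
  AllMon-act h (a ∷ as) = h a ∷ AllMon-act h as

  AllMon-scale : ∀ {P : Monomial → Set} {c p} → AllMon P p → AllMon P (scale c p)
  AllMon-scale {P} = AllMon-act λ {m} → ≡.subst P (≡.sym (map-id m))

  leading : ∀ f → f ≈ₚ [] ⊎ Leading f
  leading f with normalize f
  ... | mkNf [] _ e _ = inj₁ e
  ... | mkNf ((c , m) ∷ p) (cons c≉0 p<m _) e h =
    inj₂ (leads c≉0 (monic m (scale c⁻¹ p) (AllMon-scale p<m)) (≈ₚ-trans e normed) λ a → All.head (h a))
    where
    c⁻¹ = proj₁ (inverse c c≉0)
    normed : (c , m) ∷ p ≈ₚ scale c ((1# , m) ∷ scale c⁻¹ p)
    normed = mk≈ₚ λ φ r → ≈-sym (begin
      eval φ (scale c ((1# , m) ∷ scale c⁻¹ p))     ≈⟨ eval-scale φ c ((1# , m) ∷ scale c⁻¹ p) ⟩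
      c * (1# * φ m + eval φ (scale c⁻¹ p))         ≈⟨ *-congˡ (+-cong (*-identityˡ _) (eval-scale φ c⁻¹ p)) ⟩
      c * (φ m + c⁻¹ * eval φ p)
        ≈⟨ solve 4 (λ x y z w → x :* (y :+ z :* w) := x :* y :+ (x :* z) :* w) ≈-refl _ _ _ _ ⟩
      c * φ m + c * c⁻¹ * eval φ p
        ≈⟨ +-congˡ (≈-trans (*-congʳ (proj₂ (inverse c c≉0))) (*-identityˡ _)) ⟩
      c * φ m + eval φ p ∎)

  -- The side condition restricts the leading monomial of every summand. With `P` an upper bound
  -- this is the notion of a standard representation.
  GSpan : List Monic → (Monomial → Set) → Pol → Set (c ⊔ ℓ)
  GSpan G P = Span pol λ g t ι → g ∈ G × P (t ++ map ι (lm g))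

  gspan-mono : ∀ {G G' P Q} → (∀ {g} → g ∈ G → g ∈ G') → (∀ {m} → P m → Q m) →
               ∀ {f} → GSpan G P f → GSpan G' Q f
  gspan-mono G⊆ P⊆ = span-bind λ ι-emb (g∈ , p) → span-gen ι-emb (G⊆ g∈ , P⊆ p)

  Reducible : Monomial → List Monic → Set c
  Reducible m G = Σ Monic λ g → g ∈ G × Σ (A → A) λ ι → IsEmb ι × map ι (lm g) ⊑ m

  -- Division by renamed basis elements.

  module Division (map-mono : ∀ {ι} → IsEmb ι → ∀ {m m'} → m <ₘ m' → map ι m <ₘ map ι m')
                  (C1 : (B : List A) (π : A → A) → Dec (InEmb B π)) where

    update : (A → A) → A → A → A → A
    update π a b x = if does (x ≟A a) then b else π x

    assignments : List A → List A → List (A → A)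
    assignments [] T = id ∷ []
    assignments (a ∷ d) T = concat (map (λ π → map (update π a) T) (assignments d T))

    assignments-complete : ∀ (ι : A → A) d {T} → (∀ {a} → a ∈ d → ι a ∈ T) →
      Σ (A → A) λ π → π ∈ assignments d T × (∀ {a} → a ∈ d → ι a ≡ π a)
    assignments-complete ι [] h = id , here refl , λ ()
    assignments-complete ι (a ∷ d) {T} h with assignments-complete ι d {T} (h ∘ there)
    ... | π , π∈ , eqn =
        update π a (ι a)
      , ∈-concat⁺′ (∈-map⁺ (update π a) (h (here refl))) (∈-map⁺ (λ π → map (update π a) T) π∈)
      , agree
      where
      agree : ∀ {x} → x ∈ a ∷ d → ι x ≡ update π a (ι a) x
      agree {x} x∈ with x ≟A a
      ... | yes refl = refl
      agree (here refl) | no x≢a = ⊥-elim (x≢a refl)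
      agree (there x∈) | no _ = eqn x∈

    map-cong-∈ : ∀ {f g : A → A} m → (∀ {a} → a ∈ m → f a ≡ g a) → map f m ≡ map g m
    map-cong-∈ [] h = refl
    map-cong-∈ (a ∷ m) h = ≡.cong₂ _∷_ (h (here refl)) (map-cong-∈ m (h ∘ there))

    -- If a renaming of `lm g` divides `m`, then it sends every variable of `lm g` to a variable of
    -- `m`. That leaves finitely many candidate assignments, and C1 decides which of them extend to
    -- embeddings.
    reducible? : ∀ m G → Dec (Reducible m G)
    reducible? m G = map′ from to (any? divides? G)
      where
      Divides : Monic → Set
      Divides g = Any (λ π → InEmb (lm g) π × map π (lm g) ⊑ m) (assignments (lm g) m)
      divides? : ∀ g → Dec (Divides g)
      divides? g = any? (λ π → C1 (lm g) π ×-dec (map π (lm g) ⊑? m)) (assignments (lm g) m)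
      from : Any Divides G → Reducible m G
      from w with find w
      ... | g , g∈ , w' with find w'
      ... | π , _ , (ι , ι-emb , eqn) , div =
        g , g∈ , ι , ι-emb , ≡.subst (_⊑ m) (≡.sym (map-cong-∈ (lm g) eqn)) div
      to : Reducible m G → Any Divides G
      to (g , g∈ , ι , ι-emb , div) with assignments-complete ι (lm g) {m}
          (λ {a} a∈ → count<⇒∈ m (ℕP.<-≤-trans (∈⇒0<count (map ι (lm g)) (∈-map⁺ ι a∈)) (count-⊑ div (ι a))))
      ... | π , π∈ , eqn =
        lose g∈ (lose π∈ ((ι , ι-emb , eqn) , ≡.subst (_⊑ m) (map-cong-∈ (lm g) eqn) div))

    -- Only the leading monomial of the remainder has to be irreducible: this already refutes
    -- membership over a complete basis and yields a genuinely new element over an incomplete one.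
    record Remainder (G : List Monic) (P : Monomial → Set) (f : Pol) : Set (c ⊔ ℓ) where
      constructor remainder
      field
        {coef}      : Carrier
        coef≉0      : ¬ (coef ≈ 0#)
        rem         : Monic
        irreducible : ¬ Reducible (lm rem) G
        {rest}      : Pol
        rest∈       : GSpan G P rest
        eqn         : f ≈ₚ scale coef (pol rem) ++ rest

    Divided : List Monic → (Monomial → Set) → Pol → Set (c ⊔ ℓ)
    Divided G P f = GSpan G P f ⊎ Remainder G P f

    divided-resp : ∀ {G P f f'} → f ≈ₚ f' → Divided G P f' → Divided G P f
    divided-resp e (inj₁ s) = inj₁ (span-resp (≈ₚ-sym e) s)
    divided-resp e (inj₂ (remainder c≉0 r irr s e')) = inj₂ (remainder c≉0 r irr s (≈ₚ-trans e e'))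

    ++-swap : ∀ p q r → p ++ q ++ r ≈ₚ q ++ p ++ r
    ++-swap p q r = mk≈ₚ λ φ _ → begin
      eval φ (p ++ q ++ r)                ≈⟨ eval-++ φ p _ ⟩
      eval φ p + eval φ (q ++ r)          ≈⟨ +-congˡ (eval-++ φ q r) ⟩
      eval φ p + (eval φ q + eval φ r)    ≈⟨ solve 3 (λ x y z → x :+ (y :+ z) := y :+ (x :+ z)) ≈-refl _ _ _ ⟩
      eval φ q + (eval φ p + eval φ r)    ≈⟨ +-congˡ (eval-++ φ p r) ⟨
      eval φ q + eval φ (p ++ r)          ≈⟨ eval-++ φ q _ ⟨
      eval φ (q ++ p ++ r) ∎

    divided-++ : ∀ {G P p f} → GSpan G P p → Divided G P f → Divided G P (p ++ f)
    divided-++ s (inj₁ s') = inj₁ (span-++ s s')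
    divided-++ {p = p} s (inj₂ (remainder c≉0 r irr {q} s' e)) =
      inj₂ (remainder c≉0 r irr (span-++ s s') (≈ₚ-trans (++-cong ≈ₚ-refl e) (++-swap p (scale _ (pol r)) q)))

    shifted-tail< : ∀ {c t ι} g → IsEmb ι → AllMon (_<ₘ t ++ map ι (lm g)) (act c t ι (tail g))
    shifted-tail< {t = t} g ι-emb = AllMon-act (λ l → ++-monoʳ-<ₘ t (map-mono ι-emb l)) (tail< g)

    -- Each step uses a summand that leads exactly at `lm r` and leaves only smaller terms, so a
    -- downward closed `P` holds throughout.
    divide-monic : ∀ {G} {P : Monomial → Set} → (∀ {m m'} → m' ≤ₘ m → P m → P m') →
                   ∀ {c} → ¬ (c ≈ 0#) → ∀ r → Acc _<ₘ_ (lm r) → P (lm r) → Divided G P (scale c (pol r))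
    divide-monic {G} {P} P-closed {c} c≉0 r (acc rs) p = by-cases (reducible? (lm r) G)
      where
      by-cases : Dec (Reducible (lm r) G) → Divided G P (scale c (pol r))
      by-cases (no irr) =
        inj₂ (remainder c≉0 r irr (nil ≈ₚ-refl) (≈ₚ-reflexive (≡.sym (++-identityʳ _))))
      by-cases (yes (g , g∈ , ι , ι-emb , div)) =
        divided-resp eqn (divided-++ (span-gen ι-emb (g∈ , P-closed (inj₂ t++g≈) p)) (descend (leading f')))
        where
        t = lm r ∖ map ι (lm g)
        t++g≈ : t ++ map ι (lm g) ≈ₘ lm r
        t++g≈ = ∖-++ div
        -- The leading terms cancel, so only the two tails are listed, and every listed monomial is
        -- already below `lm r`.
        f' = scale c (tail r) ++ act (- 1# * c) t ι (tail g)
        f'< : AllMon (_<ₘ lm r) f'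
        f'< = AllP.++⁺ (AllMon-scale (tail< r)) (All.map (<ₘ-respʳ t++g≈) (shifted-tail< g ι-emb))
        descend : f' ≈ₚ [] ⊎ Leading f' → Divided G P f'
        descend (inj₁ e) = inj₁ (nil e)
        descend (inj₂ (leads c'≉0 r' e h)) =
          divided-resp e (divide-monic P-closed c'≉0 r' (rs (h f'<)) (P-closed (inj₁ (h f'<)) p))
        eqn : scale c (pol r) ≈ₚ act c t ι (pol g) ++ f'
        eqn = mk≈ₚ λ φ resp → let T = eval φ (tail r) ; X = eval (λ m → φ (t ++ map ι m)) (tail g) in ≈-sym (begin
          eval φ (act c t ι (pol g) ++ f')
            ≈⟨ ≈-trans (eval-++ φ (act c t ι (pol g)) f') (+-cong (eval-act-monic φ c t ι g) (eval-scale-+ φ c (tail r) _)) ⟩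
          (c * φ (t ++ map ι (lm g)) + c * X) + (c * T + eval φ (act (- 1# * c) t ι (tail g)))
            ≈⟨ +-cong (+-congʳ (*-congˡ (resp t++g≈)))
                      (+-congˡ (≈-trans (eval-act φ _ t ι (tail g)) (*-assoc _ _ _))) ⟩
          (c * φ (lm r) + c * X) + (c * T + - 1# * (c * X))
            ≈⟨ solve 4 (λ x y z w → (x :+ y) :+ (z :+ w) := (x :+ z) :+ (y :+ w)) ≈-refl _ _ _ _ ⟩
          (c * φ (lm r) + c * T) + (c * X + - 1# * (c * X))
            ≈⟨ +-congˡ (x-x≈0 (c * X)) ⟩
          (c * φ (lm r) + c * T) + 0#
            ≈⟨ +-identityʳ _ ⟩
          c * φ (lm r) + c * T
            ≈⟨ ≈-trans (*-congˡ (+-congʳ (*-identityˡ _))) (distribˡ c _ _) ⟨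
          c * eval φ (pol r)
            ≈⟨ eval-scale φ c (pol r) ⟨
          eval φ (scale c (pol r)) ∎)

    divide : ∀ {G} {P : Monomial → Set} → (∀ {m m'} → m' ≤ₘ m → P m → P m') →
             ∀ f → AllMon P f → Divided G P f
    divide P-closed f h with leading f
    ... | inj₁ e = inj₁ (nil e)
    ... | inj₂ (leads c≉0 r e lm∈) =
      divided-resp e (divide-monic P-closed c≉0 r (<ₘ-wf (lm r)) (lm∈ h))

    -- Buchberger's criterion.

    bounded-span : ∀ {G} {P : Monomial → Set} {f} → GSpan G P f →
                     f ≈ₚ [] ⊎ Σ Monomial λ M → P M × GSpan G (_≤ₘ M) f
    bounded-span (nil e) = inj₁ e
    bounded-span (add c t ι g ι-emb (g∈ , p) e s) with bounded-span s
    ... | inj₁ e' = inj₂ (_ , p , add c t ι g ι-emb (g∈ , inj₂ ≈ₘ-refl) e (nil e'))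
    -- The bound kept is the leading monomial of some summand, hence satisfies `P`. With `P` a
    -- strict bound, this is the descent in `span-≤⇒reducible`.
    ... | inj₂ (M , pM , s') with <ₘ-tri (t ++ map ι (lm g)) M
    ... | inj₁ l = inj₂ (M , pM , add c t ι g ι-emb (g∈ , inj₁ l) e s')
    ... | inj₂ (inj₁ e') = inj₂ (M , pM , add c t ι g ι-emb (g∈ , inj₂ e') e s')
    ... | inj₂ (inj₂ l) = inj₂ (_ , p , add c t ι g ι-emb (g∈ , inj₂ ≈ₘ-refl) e
            (gspan-mono {P = _≤ₘ M} {Q = _≤ₘ (t ++ map ι (lm g))} id (λ m≤M → inj₁ (≤ₘ-<ₘ-trans m≤M l)) s'))

    eval-δ-span : ∀ {G M f} → GSpan G (_<ₘ M) f → eval (δ M) f ≈ 0#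
    eval-δ-span {M = M} (nil e) = eval-≈ e (δ M) (δ-respects M)
    eval-δ-span {M = M} {f} (add {r = r} c t ι g ι-emb (g∈ , l) e s) = begin
      eval (δ M) f                                  ≈⟨ eval-≈ e (δ M) (δ-respects M) ⟩
      eval (δ M) (act c t ι (pol g) ++ r)           ≈⟨ eval-++ (δ M) (act c t ι (pol g)) r ⟩
      eval (δ M) (act c t ι (pol g)) + eval (δ M) r
        ≈⟨ +-cong (eval-δ-≈0 {p = act c t ι (pol g)} (All.map (λ m<M e' → <ₘ-irrefl (≈ₘ-sym e') m<M) terms<))
                  (eval-δ-span s) ⟩
      0# + 0#                                       ≈⟨ +-identityʳ 0# ⟩
      0# ∎
      where
      terms< : AllMon (_<ₘ M) (act c t ι (pol g))
      terms< = l ∷ All.map (λ l' → <ₘ-trans l' l) (shifted-tail< g ι-emb)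

    -- Stated for arbitrary cofactors and embeddings, not just for least common multiples, since
    -- this is what rewriting a representation requires. `resolved⇒overlapsCancel` derives it from
    -- finitely many pairs.
    OverlapsCancel : List Monic → Set (c ⊔ ℓ)
    OverlapsCancel G = ∀ {g g'} → g ∈ G → g' ∈ G → ∀ {t t' ι ι'} → IsEmb ι → IsEmb ι' →
      t ++ map ι (lm g) ≈ₘ t' ++ map ι' (lm g') →
      GSpan G (_<ₘ t ++ map ι (lm g)) (act 1# t ι (pol g) ++ act (- 1#) t' ι' (pol g'))

    record Top (G : List Monic) (M : Monomial) (f : Pol) : Set (c ⊔ ℓ) where
      constructor top
      field
        {coef} : Carrier
        {t}    : Monomial
        {ι}    : A → A
        g      : Monic
        g∈     : g ∈ G
        ι-emb  : IsEmb ι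
        lm≈    : t ++ map ι (lm g) ≈ₘ M
        {rest} : Pol
        rest∈  : GSpan G (_<ₘ M) rest
        eqn    : f ≈ₚ act coef t ι (pol g) ++ rest

    -- Of two summands leading at `M`, one is traded for a multiple of the other plus a cancelled
    -- overlap, which lies strictly below `M`. So at most one survives.
    isolate-top : ∀ {G} → OverlapsCancel G → ∀ {M f} → GSpan G (_≤ₘ M) f →
                  GSpan G (_<ₘ M) f ⊎ Top G M f
    isolate-top cancel (nil e) = inj₁ (nil e)
    isolate-top cancel {M} (add c t ι g ι-emb (g∈ , bound) e s) with bound | isolate-top cancel s
    ... | inj₁ l  | inj₁ s' = inj₁ (add c t ι g ι-emb (g∈ , l) e s')
    ... | inj₁ l  | inj₂ (top g' g'∈ ι'-emb lm≈ s' e') =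
      inj₂ (top g' g'∈ ι'-emb lm≈ (span-++ (span-gen {c = c} ι-emb (g∈ , l)) s')
        (≈ₚ-trans e (≈ₚ-trans (++-cong ≈ₚ-refl e') (++-swap (act c t ι (pol g)) (act _ _ _ (pol g')) _))))
    ... | inj₂ lm≈ | inj₁ s' = inj₂ (top g g∈ ι-emb lm≈ s' e)
    ... | inj₂ lm≈ | inj₂ (top {c'} {t'} {ι'} g' g'∈ ι'-emb lm≈' {r} s' e') =
      inj₂ (top {coef = c + c'} g' g'∈ ι'-emb lm≈'
        (span-++ (span-scale {c = c} (gspan-mono {P = _<ₘ (t ++ map ι (lm g))} {Q = _<ₘ M} id (<ₘ-respʳ lm≈)
          (cancel g∈ g'∈ {t} {t'} ι-emb ι'-emb (≈ₘ-trans lm≈ (≈ₘ-sym lm≈'))))) s')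
        (≈ₚ-trans e (≈ₚ-trans (++-cong ≈ₚ-refl e') exchange)))
      where
      -- c x + c' y = (c + c') y + c (x − y), where x − y is a cancelled overlap.
      exchange : act c t ι (pol g) ++ act c' t' ι' (pol g') ++ r
               ≈ₚ act (c + c') t' ι' (pol g') ++ scale c (act 1# t ι (pol g) ++ act (- 1#) t' ι' (pol g')) ++ r
      exchange = mk≈ₚ λ φ _ →
        let X = eval (λ m → φ (t ++ map ι m)) (pol g)
            Y = eval (λ m → φ (t' ++ map ι' m)) (pol g')
            R = eval φ r
            x = act 1# t ι (pol g)
            y = act (- 1#) t' ι' (pol g')
        in begin
        eval φ (act c t ι (pol g) ++ act c' t' ι' (pol g') ++ r)
          ≈⟨ ≈-trans (eval-++ φ (act c t ι (pol g)) _) (+-cong (eval-act φ c t ι (pol g))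
               (≈-trans (eval-++ φ (act c' t' ι' (pol g')) r) (+-congʳ (eval-act φ c' t' ι' (pol g'))))) ⟩
        c * X + (c' * Y + R)
          ≈⟨ +-congˡ (+-identityˡ _) ⟨
        c * X + (0# + (c' * Y + R))
          ≈⟨ +-congˡ (+-congʳ (x-x≈0 (c * Y))) ⟨
        c * X + ((c * Y + - 1# * (c * Y)) + (c' * Y + R))
          ≈⟨ solve 6 (λ c c' n X Y R → c :* X :+ ((c :* Y :+ n :* (c :* Y)) :+ (c' :* Y :+ R))
               := (c :+ c') :* Y :+ (c :* (X :+ n :* Y) :+ R)) ≈-refl c c' (- 1#) X Y R ⟩
        (c + c') * Y + (c * (X + - 1# * Y) + R)
          ≈⟨ +-congˡ (+-congʳ (*-congˡ (+-congʳ (*-identityˡ X)))) ⟨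
        (c + c') * Y + (c * (1# * X + - 1# * Y) + R)
          ≈⟨ ≈-trans (eval-++ φ (act (c + c') t' ι' (pol g')) _) (+-cong (eval-act φ (c + c') t' ι' (pol g'))
               (≈-trans (eval-scale-+ φ c (x ++ y) r) (+-congʳ (*-congˡ (≈-trans (eval-++ φ x y)
                 (+-cong (eval-act φ 1# t ι (pol g)) (eval-act φ (- 1#) t' ι' (pol g')))))))) ⟨
        eval φ (act (c + c') t' ι' (pol g') ++ scale c (x ++ y) ++ r) ∎

    Everything : Monomial → Set
    Everything _ = ⊤

    pol≉0 : ∀ r → ¬ (pol r ≈ₚ [])
    pol≉0 r e = 1≉0 (≈-trans (≈-sym (eval-δ-lm r)) (eval-≈ e (δ (lm r)) (δ-respects (lm r))))

    -- The bound `M` is lowered until a single summand with nonzero coefficient leads at it. Its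
    -- term at `M` cannot be cancelled by summands below `M`, and `pol r` cannot lead above `M`, so
    -- `M` is `lm r` and that summand divides it.
    span-≤⇒reducible : ∀ {G} → OverlapsCancel G → ∀ r {M} → Acc _<ₘ_ M → GSpan G (_≤ₘ M) (pol r) →
                       Reducible (lm r) G
    span-≤⇒reducible {G} cancel r {M} (acc rs) s = by-cases (isolate-top cancel s)
      where
      descend : GSpan G (_<ₘ M) (pol r) → Reducible (lm r) G
      descend s' with bounded-span s'
      ... | inj₁ e = ⊥-elim (pol≉0 r e)
      ... | inj₂ (M' , l , s'') = span-≤⇒reducible cancel r (rs l) s''
      by-cases : GSpan G (_<ₘ M) (pol r) ⊎ Top G M (pol r) → Reducible (lm r) G
      by-cases (inj₁ s') = descend s'
      by-cases (inj₂ (top {coef} {t} {ι} g g∈ ι-emb lm≈ {rest} s' e)) with coef ≟ 0#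
      ... | yes coef≈0 = descend (span-resp (≈ₚ-sym (≈ₚ-trans e (++-cong vanishing (≈ₚ-refl {rest})))) s')
        where
        vanishing : act coef t ι (pol g) ≈ₚ []
        vanishing = mk≈ₚ λ φ _ →
          ≈-trans (eval-act φ coef t ι (pol g)) (≈-trans (*-congʳ coef≈0) (zeroˡ _))
      ... | no coef≉0 with <ₘ-tri (lm r) M
      ... | inj₂ (inj₁ e') = g , g∈ , ι , ι-emb ,
        ⊑-trans (mk⊑ λ a → ≡.subst (count a (map ι (lm g)) ℕ.≤_)
                  (≡.sym (count-++ a t (map ι (lm g)))) (ℕP.m≤n+m _ _))
                (≈ₘ⇒⊑ (≈ₘ-trans lm≈ (≈ₘ-sym e')))
      ... | inj₂ (inj₂ M<lm) = ⊥-elim (1≉0 (≈-trans (≈-sym (eval-δ-lm r))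
              (eval-δ-span (gspan-mono {P = _≤ₘ M} {Q = _<ₘ lm r} id (λ m≤M → ≤ₘ-<ₘ-trans m≤M M<lm) s))))
      ... | inj₁ lm<M = ⊥-elim (coef≉0 (begin
        coef
          ≈⟨ *-identityʳ coef ⟨
        coef * 1#
          ≈⟨ *-congˡ (δ-≈ (≈ₘ-sym lm≈)) ⟨
        coef * δ M (t ++ map ι (lm g))
          ≈⟨ ≈-trans (+-congˡ (≈-trans (*-congˡ tail-vanishes) (zeroʳ coef))) (+-identityʳ _) ⟨
        coef * δ M (t ++ map ι (lm g)) + coef * eval (λ m → δ M (t ++ map ι m)) (tail g)
          ≈⟨ eval-act-monic (δ M) coef t ι g ⟨
        eval (δ M) (act coef t ι (pol g))
          ≈⟨ ≈-trans (+-congˡ (eval-δ-span s')) (+-identityʳ _) ⟨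
        eval (δ M) (act coef t ι (pol g)) + eval (δ M) rest
          ≈⟨ ≈-trans (eval-≈ e (δ M) (δ-respects M)) (eval-++ (δ M) (act coef t ι (pol g)) rest) ⟨
        eval (δ M) (pol r)
          ≈⟨ eval-δ-≈0 {p = pol r} ((λ e' → <ₘ-irrefl (≈ₘ-sym e') lm<M)
               ∷ All.map (λ l e' → <ₘ-irrefl (≈ₘ-sym e') (<ₘ-trans l lm<M)) (tail< r)) ⟩
        0# ∎))
        where
        tail-vanishes : eval (λ m → δ M (t ++ map ι m)) (tail g) ≈ 0#
        tail-vanishes = ≈-trans (≈-sym (≈-trans (eval-act (δ M) 1# t ι (tail g)) (*-identityˡ _)))
          (eval-δ-≈0 (All.map (λ l e' → <ₘ-irrefl (≈ₘ-sym (≈ₘ-trans lm≈ e')) l) (shifted-tail< g ι-emb)))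

    span⇒reducible : ∀ {G} → OverlapsCancel G → ∀ r → GSpan G Everything (pol r) → Reducible (lm r) G
    span⇒reducible cancel r s with bounded-span s
    ... | inj₁ e = ⊥-elim (pol≉0 r e)
    ... | inj₂ (M , _ , s') = span-≤⇒reducible cancel r (<ₘ-wf M) s'

    -- A remainder refutes membership: otherwise it would itself lie in the span and have a
    -- reducible leading monomial.
    gspan? : ∀ {G} → OverlapsCancel G → ∀ f → Dec (GSpan G Everything f)
    gspan? cancel f with divide {P = Everything} _ f (All.tabulate _)
    ... | inj₁ s = yes s
    ... | inj₂ (remainder c≉0 r irr s' e) =
      no λ s → irr (span⇒reducible cancel r (span-combination⁻ c≉0 e s s'))

    -- S-polynomials.

    vars : Pol → List A
    vars p = concat (map proj₂ p)

    act-cong-vars : ∀ {c t ι κ} p → (∀ {a} → a ∈ vars p → ι a ≡ κ a) → act c t ι p ≡ act c t κ p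
    act-cong-vars [] h = refl
    act-cong-vars {c} {t} ((d , m) ∷ p) h = ≡.cong₂ _∷_
      (≡.cong (λ k → c * d , t ++ k) (map-cong-∈ m (h ∘ ∈-++⁺ˡ)))
      (act-cong-vars p (h ∘ ∈-++⁺ʳ m))

    module _ (g g' : Monic) (π π' : A → A) where

      sLcm cofactor cofactor' : Monomial
      sLcm   = lcm (map π (lm g)) (map π' (lm g'))
      cofactor  = sLcm ∖ map π (lm g)
      cofactor' = sLcm ∖ map π' (lm g')

      -- Written with the tails only, so that all listed monomials lie below the least common
      -- multiple; `sPol-≈` identifies it with the usual difference.
      sPol : Pol
      sPol = act 1# cofactor π (tail g) ++ act (- 1#) cofactor' π' (tail g')

      cofactor-++ : cofactor ++ map π (lm g) ≈ₘ sLcm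
      cofactor-++ = ∖-++ (⊑-lcmˡ {map π (lm g)})

      cofactor'-++ : cofactor' ++ map π' (lm g') ≈ₘ sLcm
      cofactor'-++ = ∖-++ (⊑-lcmʳ {map π (lm g)})

      sPol-≈ : act 1# cofactor π (pol g) ++ act (- 1#) cofactor' π' (pol g') ≈ₚ sPol
      sPol-≈ = mk≈ₚ λ φ resp →
        let X = eval (λ m → φ (cofactor ++ map π m)) (tail g)
            Y = eval (λ m → φ (cofactor' ++ map π' m)) (tail g')
            Z = φ sLcm
        in begin
        eval φ (act 1# cofactor π (pol g) ++ act (- 1#) cofactor' π' (pol g'))
          ≈⟨ ≈-trans (eval-++ φ (act 1# cofactor π (pol g)) _)
               (+-cong (eval-act-monic φ 1# cofactor π g) (eval-act-monic φ (- 1#) cofactor' π' g')) ⟩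
        (1# * φ (cofactor ++ map π (lm g)) + 1# * X) + (- 1# * φ (cofactor' ++ map π' (lm g')) + - 1# * Y)
          ≈⟨ +-cong (+-congʳ (≈-trans (*-identityˡ _) (resp cofactor-++)))
                    (+-congʳ (*-congˡ (resp cofactor'-++))) ⟩
        (Z + 1# * X) + (- 1# * Z + - 1# * Y)
          ≈⟨ solve 4 (λ x y z w → (x :+ y) :+ (z :+ w) := (x :+ z) :+ (y :+ w)) ≈-refl _ _ _ _ ⟩
        (Z + - 1# * Z) + (1# * X + - 1# * Y)
          ≈⟨ ≈-trans (+-congʳ (x-x≈0 Z)) (+-identityˡ _) ⟩
        1# * X + - 1# * Y
          ≈⟨ +-cong (eval-act φ 1# cofactor π (tail g)) (eval-act φ (- 1#) cofactor' π' (tail g')) ⟨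
        eval φ (act 1# cofactor π (tail g)) + eval φ (act (- 1#) cofactor' π' (tail g'))
          ≈⟨ eval-++ φ (act 1# cofactor π (tail g)) _ ⟨
        eval φ sPol ∎

      sPol< : IsEmb π → IsEmb π' → AllMon (_<ₘ sLcm) sPol
      sPol< π-emb π'-emb = AllP.++⁺ (All.map (<ₘ-respʳ cofactor-++) (shifted-tail< g π-emb))
                                    (All.map (<ₘ-respʳ cofactor'-++) (shifted-tail< g' π'-emb))

    -- Reduction to finitely many critical pairs.

    module Completion
      (C2 : (B B' : List A) → Σ (List ((A → A) × (A → A))) λ F →
         (∀ {p} → p ∈ F → InEmb B (proj₁ p) × InEmb B' (proj₂ p))
       × (∀ ι ι' → IsEmb ι → IsEmb ι' →
            Σ (A → A) λ κ → IsEmb κ × Σ ((A → A) × (A → A)) λ p → p ∈ F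
              × (∀ {b} → b ∈ B → ι b ≡ κ (proj₁ p b))
              × (∀ {b} → b ∈ B' → ι' b ≡ κ (proj₂ p b)))) where

      -- C2 is asked about all variables of both polynomials: embeddings that agree on the leading
      -- monomials may still differ on the tails.
      pairs : Monic → Monic → List ((A → A) × (A → A))
      pairs g g' = proj₁ (C2 (vars (pol g)) (vars (pol g')))

      -- The maps in `p` are meaningful only on these variables. Here `π` and `π'` agree with them
      -- there; `resolve` takes embeddings that extend them.
      record Resolved (G : List Monic) (g g' : Monic) (p : (A → A) × (A → A)) : Set (c ⊔ ℓ) where
        constructor resolved
        field
          {π π'}  : A → A
          π-agree : ∀ {a} → a ∈ vars (pol g) → π a ≡ proj₁ p a
          π'-agree : ∀ {a} → a ∈ vars (pol g') → π' a ≡ proj₂ p a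
          span    : GSpan G (_<ₘ sLcm g g' π π') (sPol g g' π π')

      -- Every overlap is obtained from one of the finitely many overlaps given by C2 by
      -- applying an embedding κ and multiplying by a monomial u.
      resolved⇒overlapsCancel : ∀ {G} →
        (∀ {g} → g ∈ G → ∀ {g'} → g' ∈ G → ∀ {p} → p ∈ pairs g g' → Resolved G g g' p) → OverlapsCancel G
      resolved⇒overlapsCancel {G} h {g} {g'} g∈ g'∈ {t} {t'} {ι} {ι'} ι-emb ι'-emb e
        with proj₂ (proj₂ (C2 (vars (pol g)) (vars (pol g')))) ι ι' ι-emb ι'-emb
      ... | κ , κ-emb@(κ-inj , _) , p , p∈ , ι-eq , ι'-eq with h g∈ g'∈ p∈
      ... | resolved {π} {π'} π-agree π'-agree s =
        span-resp (≈ₚ-trans (act-cong κ-inj (≈ₚ-sym (sPol-≈ g g' π π')))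
                    (≈ₚ-trans (≈ₚ-reflexive (act-++ 1# u κ (act 1# s₁ π (pol g)) _))
                      (++-cong (component {ι = ι} {π} g (*-identityˡ 1#) ι≡ u++s₁)
                               (component {ι = ι'} {π'} g' (*-identityˡ (- 1#)) ι'≡ u++s₂))))
          (span-act κ-emb (λ {x} {s} {ι} (x∈ , l) → x∈ , shift {s} {ι} {x} l) s)
        where
        N = t ++ map ι (lm g)
        M = sLcm g g' π π'
        s₁ = cofactor g g' π π'
        s₂ = cofactor' g g' π π'
        ι≡ : ∀ {a} → a ∈ vars (pol g) → ι a ≡ κ (π a)
        ι≡ a∈ = ≡.trans (ι-eq a∈) (≡.cong κ (≡.sym (π-agree a∈)))
        ι'≡ : ∀ {a} → a ∈ vars (pol g') → ι' a ≡ κ (π' a)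
        ι'≡ a∈ = ≡.trans (ι'-eq a∈) (≡.cong κ (≡.sym (π'-agree a∈)))
        map-lm : ∀ {ι π : A → A} f → (∀ {a} → a ∈ vars (pol f) → ι a ≡ κ (π a)) →
                 map ι (lm f) ≡ map κ (map π (lm f))
        map-lm f eqn = ≡.trans (map-cong-∈ (lm f) (eqn ∘ ∈-++⁺ˡ)) (map-∘ (lm f))
        κM⊑N : map κ M ⊑ N
        κM⊑N = map-lcm-⊑ κ-inj
          (≡.subst (_⊑ N) (map-lm {ι} {π} g ι≡) (⊑-++ʳ t))
          (≡.subst (_⊑ N) (map-lm {ι'} {π'} g' ι'≡) (⊑-trans (⊑-++ʳ t') (≈ₘ⇒⊑ (≈ₘ-sym e))))
        -- `N` is a common multiple of both renamed leading monomials, hence a multiple of the image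
        -- of their least common multiple; `u` is the quotient.
        u = N ∖ map κ M
        u++κM : u ++ map κ M ≈ₘ N
        u++κM = ∖-++ κM⊑N
        -- A cofactor is determined by its product with the leading monomial, so cancelling the
        -- latter identifies `u` times the renamed cofactor with `t`, respectively `t'`.
        factor : ∀ {ι π r s f} → (∀ {a} → a ∈ vars (pol f) → ι a ≡ κ (π a)) →
                 s ++ map π (lm f) ≈ₘ M → N ≈ₘ r ++ map ι (lm f) → u ++ map κ s ≈ₘ r
        factor {ι} {π} {r} {s} {f} eqn e₁ e₂ = ++-cancelʳ-≈ₘ (map ι (lm f))
          (≈ₘ-trans (≈ₘ-reflexive (≡.trans (++-assoc u (map κ s) (map ι (lm f)))
                      (≡.cong (u ++_) (≡.trans (≡.cong (map κ s ++_) (map-lm {ι} {π} f eqn))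
                        (≡.sym (map-++ κ s (map π (lm f))))))))
            (≈ₘ-trans (++-cong-≈ₘ ≈ₘ-refl (map-≈ₘ κ-inj e₁)) (≈ₘ-trans u++κM e₂)))
        u++s₁ : u ++ map κ s₁ ≈ₘ t
        u++s₁ = factor {ι} {π} {f = g} ι≡ (cofactor-++ g g' π π') ≈ₘ-refl
        u++s₂ : u ++ map κ s₂ ≈ₘ t'
        u++s₂ = factor {ι'} {π'} {f = g'} ι'≡ (cofactor'-++ g g' π π') e
        component : ∀ {ι π c r s d} f → 1# * c ≈ d → (∀ {a} → a ∈ vars (pol f) → ι a ≡ κ (π a)) →
                    u ++ map κ s ≈ₘ r → act 1# u κ (act c s π (pol f)) ≈ₚ act d r ι (pol f)
        component {ι} {π} {c} {r} {s} f e₁ eqn e₂ = ≈ₚ-trans (act-act 1# u κ c s π (pol f))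
          (≈ₚ-trans (act-cong-coeff e₁ e₂) (≈ₚ-reflexive (≡.sym (act-cong-vars (pol f) eqn))))
        shift : ∀ {s ι x} → s ++ map ι (lm x) <ₘ M → (u ++ map κ s) ++ map (κ ∘ ι) (lm x) <ₘ N
        shift {s} {ι} {x} l = <ₘ-respʳ u++κM (<ₘ-respˡ
          (≈ₘ-reflexive (≡.trans (≡.cong (u ++_) (≡.trans (map-++ κ s (map ι (lm x)))
              (≡.cong (map κ s ++_) (≡.sym (map-∘ (lm x))))))
            (≡.sym (++-assoc u (map κ s) (map (κ ∘ ι) (lm x))))))
          (++-monoʳ-<ₘ u (map-mono κ-emb l)))

      record NewElement (G : List Monic) : Set (c ⊔ ℓ) where
        constructor new
        field
          element     : Monic
          irreducible : ¬ Reducible (lm element) G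
          element∈    : GSpan G Everything (pol element)
      open NewElement

      resolve : ∀ {G g g' p} → g ∈ G → g' ∈ G → p ∈ pairs g g' → Resolved G g g' p ⊎ NewElement G
      resolve {G} {g} {g'} g∈ g'∈ p∈ with proj₁ (proj₂ (C2 (vars (pol g)) (vars (pol g')))) p∈
      ... | (π , π-emb , π-agree) , (π' , π'-emb , π'-agree)
        -- Dividing under the bound `sLcm` makes a vanishing remainder a witness of `Resolved`,
        -- which a division without bound would not give.
        with divide {G} {_<ₘ sLcm g g' π π'} ≤ₘ-<ₘ-trans (sPol g g' π π') (sPol< g g' π π' π-emb π'-emb)
      ... | inj₁ s = inj₁ (resolved {π = π} {π'} π-agree π'-agree s)
      ... | inj₂ (remainder c≉0 r irr s e) = inj₂ (new r irr (span-combination⁻ c≉0 e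
              (span-resp (sPol-≈ g g' π π') (span-++ (span-gen π-emb (g∈ , tt)) (span-gen π'-emb (g'∈ , tt))))
              (gspan-mono {P = _<ₘ sLcm g g' π π'} {Q = Everything} id _ s)))

      complete-or-extend : ∀ G → OverlapsCancel G ⊎ NewElement G
      complete-or-extend G with search G (λ {g} g∈ → search G (λ {g'} g'∈ →
        search (pairs g g') (λ p∈ → resolve g∈ g'∈ p∈)))
      ... | inj₁ h = inj₁ (resolved⇒overlapsCancel h)
      ... | inj₂ r = inj₂ r

      -- The sequence of bases and the decision.

      module _ (𝓑 : List Pol) where

        -- The two invariants keep the ideal of `elements` equal to that of `𝓑` at every stage.
        record Basis : Set (c ⊔ ℓ) where
          constructor basis
          field
            elements : List Monic
            sound    : ∀ {g} → g ∈ elements → Span id (λ b _ _ → b ∈ 𝓑) (pol g)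
            full     : ∀ {b} → b ∈ 𝓑 → GSpan elements Everything b
        open Basis

        gspan⇒span : ∀ S {f} → GSpan (elements S) Everything f → Span id (λ b _ _ → b ∈ 𝓑) f
        gspan⇒span S = span-bind λ ι-emb (g∈ , _) → span-act ι-emb id (sound S g∈)

        span⇒gspan : ∀ S {f} → Span id (λ b _ _ → b ∈ 𝓑) f → GSpan (elements S) Everything f
        span⇒gspan S = span-bind λ ι-emb b∈ → span-act ι-emb (λ (x∈ , _) → x∈ , tt) (full S b∈)

        monics : (𝓑' : List Pol) → (∀ {b} → b ∈ 𝓑' → b ∈ 𝓑) → Σ (List Monic) λ G →
                 (∀ {g} → g ∈ G → Span id (λ b _ _ → b ∈ 𝓑) (pol g)) ×
                 (∀ {b} → b ∈ 𝓑' → GSpan G Everything b)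
        monics [] _ = [] , (λ ()) , λ ()
        monics (b ∷ 𝓑') 𝓑'⊆ with monics 𝓑' (𝓑'⊆ ∘ there) | leading b
        ... | G , s , f | inj₁ e = G , s , λ { (here refl) → nil e ; (there b∈) → f b∈ }
        ... | G , s , f | inj₂ (leads {lc} lc≉0 g e _) =
            g ∷ G
          , (λ { (here refl) → span-combination⁻ lc≉0 (≈ₚ-trans e (≈ₚ-reflexive (≡.sym (++-identityʳ _))))
                                 (span-resp (scale-1 ≈-refl b)
                                   (span-gen {c = 1#} {[]} (Embeddings.id-emb D) (𝓑'⊆ (here refl))))
                                 (nil ≈ₚ-refl)
               ; (there g∈) → s g∈ })
          , λ { (here refl) → span-resp (≈ₚ-sym e) (span-gen (Embeddings.id-emb D) (here refl , tt))
              ; (there b∈) → gspan-mono {P = Everything} {Q = Everything} there _ (f b∈) }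

        initial : Basis
        initial = let G , s , f = monics 𝓑 id in basis G s f

        Progress : Basis → Set (c ⊔ ℓ)
        Progress S = OverlapsCancel (elements S) ⊎ NewElement (elements S)

        opaque
          progress : ∀ S → Progress S
          progress S = complete-or-extend (elements S)

        -- The outcome is an argument so that `run` and `exponents` analyse one and the same value
        -- of `progress`.
        extend : ∀ S → Progress S → Basis
        extend S (inj₁ _) = S
        extend S (inj₂ (new r _ r∈)) = basis (r ∷ elements S)
          (λ { (here refl) → gspan⇒span S r∈ ; (there g∈) → sound S g∈ })
          λ b∈ → gspan-mono {P = Everything} {Q = Everything} there _ (full S b∈)

        extend-⊇ : ∀ S x {g} → g ∈ elements S → g ∈ elements (extend S x)
        extend-⊇ S (inj₁ _) g∈ = g∈
        extend-⊇ S (inj₂ _) g∈ = there g∈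

        run : ℕ → Basis
        run ℕ.zero = initial
        run (ℕ.suc n) = extend (run n) (progress (run n))

        run-⊇ : ∀ {i j} → i ℕ.≤′ j → ∀ {g} → g ∈ elements (run i) → g ∈ elements (run j)
        run-⊇ ℕ.≤′-refl g∈ = g∈
        run-⊇ (ℕ.≤′-step {j} i≤j) g∈ = extend-⊇ (run j) (progress (run j)) (run-⊇ i≤j g∈)

        -- The labelling of a completed basis is a dummy: a pair of new leading monomials is never
        -- related by ⇝, so a pair provided by the well quasi order involves a completed basis.
        exponents : ∀ S → Progress S → Labelling
        exponents _ (inj₁ _) = lab [] λ _ → 0
        exponents _ (inj₂ (new r _ _)) = lab (lm r) λ a → count a (lm r)

        ⇝⇒complete : ∀ S S' (x : Progress S) (x' : Progress S') →
                     (∀ {g} → g ∈ elements (extend S x) → g ∈ elements S') → exponents S x ⇝ exponents S' x' →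
                     OverlapsCancel (elements S) ⊎ OverlapsCancel (elements S')
        ⇝⇒complete _ _ (inj₁ cancel) _ _ _ = inj₁ cancel
        ⇝⇒complete _ _ (inj₂ _) (inj₁ cancel) _ _ = inj₂ cancel
        -- By injectivity of `ι`, comparing exponents on the variables of `lm r` amounts to
        -- divisibility after renaming, and `r` already belongs to the later basis.
        ⇝⇒complete _ _ (inj₂ (new r _ _)) (inj₂ (new r' irr _)) ⊆S' (ι , ι-emb , h) =
          ⊥-elim (irr (r , ⊆S' (here refl) , ι , ι-emb , ⊑-on-map (proj₁ ι-emb) (lm r) λ a∈ → proj₂ (h a∈)))

        complete-basis : OmegaWellStructured D → Σ Basis λ S → OverlapsCancel (elements S)
        complete-basis wqo =
          let i , j , i<j , ℓi⇝ℓj = wqo λ n → exponents (run n) (progress (run n))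
          in [ run i ,_ , run j ,_ ]′
               (⇝⇒complete (run i) (run j) (progress (run i)) (progress (run j))
                 (run-⊇ (ℕP.≤⇒≤′ i<j)) ℓi⇝ℓj)

        ideal? : OmegaWellStructured D → ∀ f → Dec (InEqIdeal f 𝓑)
        ideal? wqo f = let S , cancel = complete-basis wqo in
          map′ (span⇒ideal ∘ gspan⇒span S) (span⇒gspan S ∘ ideal⇒span) (gspan? cancel f)

theorem7p1 : {c ℓ : Level} (K : ComputableField c ℓ) (D : Domain) →
    OmegaWellStructured D → WellOrdered D → Computable D →
    (f : Poly.Pol K D) (𝓑 : List (Poly.Pol K D)) → Dec (Poly.InEqIdeal K D f 𝓑)
theorem7p1 K D wqo (φ , wo) computable f 𝓑 = ideal? 𝓑 wqo f
  where
  open Computable computable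
  open Polynomials K D wo
  open Division (λ ι-emb → map-<ₘ (proj₁ ι-emb) (proj₁ (Embeddings.defRel-emb D ι-emb φ))) C1
  open Completion C2
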